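{- Let $f(x)=(1+x)\,\dfrac{x}{\sin x}=\sum_{k\ge0}a_kx^k/k!$ and let $\ddot H_n=\det(a_{2i+j})_{0\le i,j\le n-1}$ for $n\ge1$, $\ddot H_0=1$. Set $$Q(k)=\frac{144\cdot 64^{\,k}\;(k!)^{5}\,\bigl((k+1)!\bigr)^{6}\,(2k)!\,(2k+1)!}{(3k)!\,(3k+3)!\,(3k+4)!}\,.$$ Then the determinants obey the two-step recurrence $\ddot H_{n+2}=\tfrac23\,Q(n)\,\ddot H_{n}$ for all $n\ge0$, and hence, for all $N\ge0$, $$\ddot H_{2N}=\Bigl(\tfrac23\Bigr)^{N}\prod_{k=0}^{N-1}Q(2k), \qquad \ddot H_{2N+1}=\Bigl(\tfrac23\Bigr)^{N}\prod_{k=0}^{N-1}Q(2k+1).$$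
   Context: $x/\sin x$ denotes the even power series with constant term $1$. Empty products equal $1$. -}

module Defs where

open import Data.Fin.Base using (Fin; zero; suc; toℕ; punchIn)
open import Data.Integer.Base as ℤ using (ℤ; +_)
open import Data.Nat.Base as ℕ using (ℕ; zero; suc; _∸_; _!)
open import Data.Nat.Properties using (_!≢0; m*n≢0)
open import Data.Rational.Base
open import Data.Rational.Properties
open import Data.Vec.Functional using (Vector; head; []; _∷_)
open import Relation.Binary.PropositionalEquality
open import Algebra.Definitions.RawSemiring +-*-rawSemiring using (_^_)
  renaming (sum to ∑)
open import Algebra.Properties.Monoid.Sum +-0-monoid using (sum-cong-≗)

------------------------------------------------------------------------
-- Formal power series over ℚ, given by their coefficients

Series : Set
Series = ℕ → ℚ

infixl 7 _⊛_

_⊛_ : Series → Series → Series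
(f ⊛ g) n = ∑ {suc n} λ i → f (toℕ i) * g (n ∸ toℕ i)

one : Series
one zero    = 1ℚ
one (suc _) = 0ℚ

X : Series
X (suc zero) = 1ℚ
X _          = 0ℚ

1+X : Series
1+X n = one n + X n

-- For a series s with constant term 1, `recips s n` lists the coefficients
-- of 1/s of degrees n, n-1, …, 0, in this order; see `⊛-recip` below.

recips : Series → ∀ n → Vector ℚ (suc n)
recips s zero    = 1ℚ ∷ []
recips s (suc n) = (- ∑ {suc n} λ i → s (suc (toℕ i)) * recips s n i) ∷ recips s n

recip : Series → Series
recip s n = head (recips s n)

-- The values at 0 of the successive derivatives of sin: 0, 1, 0, -1, 0, 1, …

sin⁽_⁾0 : ℕ → ℤ
sin⁽ zero ⁾0        = + 0
sin⁽ suc zero ⁾0    = + 1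
sin⁽ suc (suc n) ⁾0 = ℤ.- sin⁽ n ⁾0

sin : Series
sin n = (sin⁽ n ⁾0 / (n !)) {{n !≢0}}

sinX/X : Series
sinX/X n = sin (suc n)

X/sinX : Series
X/sinX = recip sinX/X

------------------------------------------------------------------------
-- X/sinX is indeed the quotient of X by sin X

private
  recips≗recip : ∀ s n (i : Fin (suc n)) → recips s n i ≡ recip s (n ∸ toℕ i)
  recips≗recip s n       zero    = refl
  recips≗recip s (suc n) (suc i) = recips≗recip s n i

⊛-recip : ∀ s → s 0 ≡ 1ℚ → ∀ n → (s ⊛ recip s) n ≡ one n
⊛-recip s s₀≡1 zero    = trans (+-identityʳ _) (trans (*-identityʳ _) s₀≡1)
⊛-recip s s₀≡1 (suc n) = begin
  s 0 * - r + t  ≡⟨ cong (λ c → c * - r + t) s₀≡1 ⟩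
  1ℚ * - r + t   ≡⟨ cong (_+ t) (*-identityˡ (- r)) ⟩
  - r + t        ≡⟨ cong (λ u → - r + u) (sum-cong-≗ λ i →
                      cong (s (suc (toℕ i)) *_) (sym (recips≗recip s n i))) ⟩
  - r + r        ≡⟨ +-inverseˡ r ⟩
  0ℚ             ∎
  where
  open ≡-Reasoning
  r = ∑ {suc n} λ i → s (suc (toℕ i)) * recips s n i
  t = ∑ {suc n} λ i → s (suc (toℕ i)) * recip s (n ∸ toℕ i)

sin⊛X/sinX : ∀ n → (sin ⊛ X/sinX) n ≡ X n
sin⊛X/sinX zero    = refl
sin⊛X/sinX (suc n) = begin
  0ℚ * X/sinX (suc n) + (sinX/X ⊛ X/sinX) n
    ≡⟨ cong (_+ (sinX/X ⊛ X/sinX) n) (*-zeroˡ (X/sinX (suc n))) ⟩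
  0ℚ + (sinX/X ⊛ X/sinX) n
    ≡⟨ +-identityˡ _ ⟩
  (sinX/X ⊛ X/sinX) n
    ≡⟨ ⊛-recip sinX/X refl n ⟩
  one n
    ≡⟨ one≡X n ⟩
  X (suc n) ∎
  where
  open ≡-Reasoning
  one≡X : ∀ n → one n ≡ X (suc n)
  one≡X zero    = refl
  one≡X (suc _) = refl

------------------------------------------------------------------------
-- Determinants, by Laplace expansion along the first row

det : ∀ {n} → (Fin n → Fin n → ℚ) → ℚ
det {zero}  A = 1ℚ
det {suc n} A = ∑ λ j →
  (- 1ℚ) ^ toℕ j * (A zero j * det λ i k → A (suc i) (punchIn j k))

------------------------------------------------------------------------

f : Series
f = 1+X ⊛ X/sinX

a : ℕ → ℚ
a k = + (k !) / 1 * f k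

Ḧ : ℕ → ℚ
Ḧ n = det {n} λ i j → a (2 ℕ.* toℕ i ℕ.+ toℕ j)

Q-num Q-den : ℕ → ℕ
Q-num k = 144 ℕ.* 64 ℕ.^ k ℕ.* (k !) ℕ.^ 5 ℕ.* ((k ℕ.+ 1) !) ℕ.^ 6
          ℕ.* (2 ℕ.* k) ! ℕ.* (2 ℕ.* k ℕ.+ 1) !
Q-den k = (3 ℕ.* k) ! ℕ.* (3 ℕ.* k ℕ.+ 3) ! ℕ.* (3 ℕ.* k ℕ.+ 4) !

Q-den≢0 : ∀ k → ℕ.NonZero (Q-den k)
Q-den≢0 k = m*n≢0 _ _
  {{m*n≢0 _ _ {{(3 ℕ.* k) !≢0}} {{(3 ℕ.* k ℕ.+ 3) !≢0}}}}
  {{(3 ℕ.* k ℕ.+ 4) !≢0}}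

Q : ℕ → ℚ
Q k = (+ Q-num k / Q-den k) {{Q-den≢0 k}}

{-# OPTIONS --safe #-}

-- Write D for d/dx, so that a k = (D^k f)(0), and put φᵢ = ∏_{l<i} (D² + (2l+1)²),
-- ψᵢ = D ∏_{1≤l≤i} (D² + (2l)²).  By induction on i,
--   ψᵢ (sin · h) = sin · D φᵢ h + (2i+1) cos · φᵢ h.
-- For h = f the left side is ψᵢ (x + x²), and comparing values and first derivatives at 0
-- gives (φᵢ f)(0) and (D φᵢ f)(0).  With ξ₀ = 1, ξ₁ = D, ξ_{j+2} = (D² + j²) ξ_j it follows
-- that (φᵢ ξ_j f)(0) is a product of a function of i, a function of j and 1/(2i+j+1).  Both
-- changes of basis are unitriangular, so Ḧ n is, up to explicit factors, the Cauchy
-- determinant of 1/(2i+j+1).  Explicit Neville elimination on that Cauchy matrix produces a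
-- combination of D^j f, j ≤ n, whose derivatives of orders 0, 2, …, 2(n-1) vanish at 0;
-- substituting it for the last column gives Ḧ (n+1) as a multiple of Ḧ n.

module Submission where

open import Algebra.Bundles using (CommutativeRing)
open import Data.Fin.Base using (Fin; zero; suc; toℕ; punchIn; inject₁; fromℕ; fromℕ<)
open import Data.Fin.Induction using (>-weakInduction)
open import Data.Fin.Properties using (toℕ-inject₁; toℕ-fromℕ; toℕ-fromℕ<; toℕ<n; toℕ≤pred[n])
open import Data.Integer.Base as ℤ using ()
import Data.Integer.Properties as ℤ
open import Data.Nat.Base as ℕ using (ℕ; zero; suc; _∸_; _!)
import Data.Nat.Properties as ℕ
open import Data.Nat.Tactic.RingSolver using (solve-∀)
open import Data.Product.Base using (_×_; _,_; ∃-syntax)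
open import Data.Rational.Base
open import Data.Rational.Properties
open import Data.Rational.Solver using (module +-*-Solver)
open import Data.Rational.Unnormalised.Base as ℚᵘ using (mkℚᵘ; *≡*)
import Data.Rational.Unnormalised.Properties as ℚᵘ
open import Data.Sum.Base using (_⊎_; inj₁; inj₂)
open import Function.Base using (_∘_)
open import Relation.Binary.PropositionalEquality
open import Relation.Nullary.Negation using (contradiction)
open import Algebra.Definitions.RawSemiring +-*-rawSemiring using (product; _^_)
  renaming (sum to ∑)
open import Algebra.Properties.Monoid.Sum +-0-monoid
  using (sum-cong-≗; sum-init-last; sum-replicate-zero)
open import Algebra.Properties.Monoid.Sum *-1-monoid using ()
  renaming (sum-init-last to product-init-last; sum-cong-≗ to product-cong-≗)
open import Algebra.Properties.CommutativeMonoid.Sum +-0-commutativeMonoid using (∑-distrib-+)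
open import Algebra.Properties.Semiring.Sum (CommutativeRing.semiring +-*-commutativeRing)
  using (*-distribˡ-sum)
open import Defs
open +-*-Solver
open ≡-Reasoning

-- Determinants

Matrix : ℕ → ℕ → Set
Matrix m n = Fin m → Fin n → ℚ

private variable
  m n : ℕ

minor : Matrix (suc m) (suc n) → Fin (suc n) → Matrix m n
minor A j i k = A (suc i) (punchIn j k)

laplaceTerm : Matrix (suc n) (suc n) → Fin (suc n) → ℚ
laplaceTerm A j = (- 1ℚ) ^ toℕ j * (A zero j * det (minor A j))

det-cong : {A B : Matrix n n} → (∀ i j → A i j ≡ B i j) → det A ≡ det B
det-cong {zero}  A≗B = refl
det-cong {suc n} A≗B = sum-cong-≗ λ j → cong ((- 1ℚ) ^ toℕ j *_)
  (cong₂ _*_ (A≗B zero j) (det-cong λ i k → A≗B (suc i) (punchIn j k)))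

∑-zero : {t : Fin n → ℚ} → (∀ i → t i ≡ 0ℚ) → ∑ t ≡ 0ℚ
∑-zero {n} t≗0 = trans (sum-cong-≗ t≗0) (sum-replicate-zero n)

-- The adjacent transposition of the indices `inject₁ k` and `suc k`.
swap : Fin n → Fin (suc n) → Fin (suc n)
swap zero    zero          = suc zero
swap zero    (suc zero)    = zero
swap zero    (suc (suc j)) = suc (suc j)
swap (suc k) zero          = zero
swap (suc k) (suc j)       = suc (swap k j)

∑-swap : (k : Fin n) (t : Fin (suc n) → ℚ) → ∑ (t ∘ swap k) ≡ ∑ t
∑-swap zero    t = solve 3 (λ x y z → x :+ (y :+ z) := y :+ (x :+ z)) refl (t (suc zero)) (t zero) _
∑-swap (suc k) t = cong (t zero +_) (∑-swap k (t ∘ suc))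

swap-fromℕ : (k : Fin n) → swap (inject₁ k) (fromℕ (suc n)) ≡ fromℕ (suc n)
swap-fromℕ zero    = refl
swap-fromℕ (suc k) = cong suc (swap-fromℕ k)

sgn : Fin n → ℚ
sgn j = (- 1ℚ) ^ toℕ j

-- The two exchanged columns are neighbours: deleting a third column keeps them so, and deleting one
-- of the two leaves the same list of columns as deleting the other, at a position of opposite sign.
swap-punchIn : (k : Fin (suc n)) (j : Fin (suc (suc n))) →
  (swap k j ≡ j × ∃[ k′ ] ∀ x → swap k (punchIn j x) ≡ punchIn j (swap k′ x))
  ⊎ ((∀ x → swap k (punchIn j x) ≡ punchIn (swap k j) x) × sgn (swap k j) ≡ - sgn j)
swap-punchIn zero zero = inj₂ ((λ { zero → refl ; (suc x) → refl }) , refl)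
swap-punchIn zero (suc zero) = inj₂ ((λ { zero → refl ; (suc x) → refl }) , refl)
swap-punchIn {suc n} zero (suc (suc j)) = inj₁ (refl , zero ,
  λ { zero → refl ; (suc zero) → refl ; (suc (suc x)) → refl })
swap-punchIn (suc k) zero = inj₁ (refl , k , λ x → refl)
swap-punchIn {suc n} (suc k) (suc j) with swap-punchIn k j
... | inj₁ (fix , k′ , comm) = inj₁ (cong suc fix , suc k′ ,
        λ { zero → refl ; (suc x) → cong suc (comm x) })
... | inj₂ (comm , sign) = inj₂ ((λ { zero → refl ; (suc x) → cong suc (comm x) }) ,
        trans (cong (- 1ℚ *_) sign) (sym (neg-distribʳ-* (- 1ℚ) (sgn j))))

-- In the Laplace expansion a fixed column gets its sign from the induction hypothesis for its
-- minor, and the two exchanged columns trade terms at positions of opposite sign.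
det-swap : (k : Fin n) (A : Matrix (suc n) (suc n)) → det (λ i j → A i (swap k j)) ≡ - det A
det-swap {suc n} k A = begin
  ∑ (laplaceTerm A∘swap)
    ≡⟨ sum-cong-≗ term ⟩
  ∑ (λ j → - 1ℚ * laplaceTerm A (swap k j))
    ≡⟨ ∑-swap k (λ j → - 1ℚ * laplaceTerm A j) ⟩
  ∑ (λ j → - 1ℚ * laplaceTerm A j)
    ≡⟨ *-distribˡ-sum (- 1ℚ) (laplaceTerm A) ⟨
  - 1ℚ * det A
    ≡⟨ neg-distribˡ-* 1ℚ (det A) ⟨
  - (1ℚ * det A)
    ≡⟨ cong -_ (*-identityˡ (det A)) ⟩
  - det A ∎
  where
  A∘swap : Matrix _ _
  A∘swap i j = A i (swap k j)
  term : ∀ j → laplaceTerm A∘swap j ≡ - 1ℚ * laplaceTerm A (swap k j)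
  term j with swap-punchIn k j
  ... | inj₁ (fix , k′ , comm) = begin
    sgn j * (A zero (swap k j) * det (minor A∘swap j))
      ≡⟨ cong (λ d → sgn j * (A zero (swap k j) * d)) (trans
           (det-cong λ i x → cong (A (suc i)) (comm x))
           (det-swap k′ (minor A j))) ⟩
    sgn j * (A zero (swap k j) * - det (minor A j))
      ≡⟨ cong (λ l → sgn l * (A zero (swap k j) * - det (minor A l))) fix ⟨
    sgn (swap k j) * (A zero (swap k j) * - det (minor A (swap k j)))
      ≡⟨ solve 3 (λ s x d → s :* (x :* :- d) := con (- 1ℚ) :* (s :* (x :* d))) refl (sgn (swap k j)) (A zero (swap k j)) (det (minor A (swap k j))) ⟩
    - 1ℚ * laplaceTerm A (swap k j) ∎
  ... | inj₂ (comm , sign) = begin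
    sgn j * (A zero (swap k j) * det (minor A∘swap j))
      ≡⟨ cong (λ d → sgn j * (A zero (swap k j) * d))
           (det-cong λ i x → cong (A (suc i)) (comm x)) ⟩
    sgn j * (A zero (swap k j) * det (minor A (swap k j)))
      ≡⟨ solve 3 (λ s x d → s :* (x :* d) := con (- 1ℚ) :* (:- s :* (x :* d))) refl (sgn j) (A zero (swap k j)) (det (minor A (swap k j))) ⟩
    - 1ℚ * (- sgn j * (A zero (swap k j) * det (minor A (swap k j))))
      ≡⟨ cong (λ s → - 1ℚ * (s * (A zero (swap k j) * det (minor A (swap k j))))) sign ⟨
    - 1ℚ * laplaceTerm A (swap k j) ∎

p≡-p⇒p≡0 : ∀ p → p ≡ - p → p ≡ 0ℚ
p≡-p⇒p≡0 p p≡-p = begin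
  p               ≡⟨ solve 1 (λ p → p := con ½ :* (p :+ p)) refl p ⟩
  ½ * (p + p)     ≡⟨ cong (λ q → ½ * (p + q)) p≡-p ⟩
  ½ * (p + - p)   ≡⟨ cong (½ *_) (+-inverseʳ p) ⟩
  ½ * 0ℚ          ≡⟨⟩
  0ℚ              ∎

swap-fixes : (k : Fin n) (v : Fin (suc n) → ℚ) → v (inject₁ k) ≡ v (suc k) →
             ∀ j → v (swap k j) ≡ v j
swap-fixes zero    v eq zero          = sym eq
swap-fixes zero    v eq (suc zero)    = eq
swap-fixes zero    v eq (suc (suc j)) = refl
swap-fixes (suc k) v eq zero          = refl
swap-fixes (suc k) v eq (suc j)       = swap-fixes k (v ∘ suc) eq j

-- Downward induction on k: exchanging columns k and k + 1 moves the copy of the last column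
-- one step towards it.
det-repeatedLast : (k : Fin n) (A : Matrix (suc n) (suc n)) →
  (∀ i → A i (inject₁ k) ≡ A i (fromℕ n)) → det A ≡ 0ℚ
det-repeatedLast {suc n} = >-weakInduction P adjacent step
  where
  P : Fin (suc n) → Set
  P k = (A : Matrix (suc (suc n)) (suc (suc n))) →
        (∀ i → A i (inject₁ k) ≡ A i (fromℕ (suc n))) → det A ≡ 0ℚ
  adjacent : P (fromℕ n)
  adjacent A eq = p≡-p⇒p≡0 (det A) (begin
    det A                                 ≡⟨ det-cong (λ i → swap-fixes (fromℕ n) (A i) (eq i)) ⟨
    det (λ i j → A i (swap (fromℕ n) j))  ≡⟨ det-swap (fromℕ n) A ⟩
    - det A                               ∎)
  step : ∀ k → P (suc k) → P (inject₁ k)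
  step k ih A eq = begin
    det A                                           ≡⟨ solve 1 (λ d → d := :- :- d) refl (det A) ⟩
    - - det A                                       ≡⟨ cong -_ (det-swap (inject₁ k) A) ⟨
    - det (λ i j → A i (swap (inject₁ k) j))        ≡⟨ cong -_ (ih (λ i j → A i (swap (inject₁ k) j)) λ i → begin
      A i (swap (inject₁ k) (suc (inject₁ k)))        ≡⟨ cong (A i) (swap-suc (inject₁ k)) ⟩
      A i (inject₁ (inject₁ k))                       ≡⟨ eq i ⟩
      A i (fromℕ (suc n))                             ≡⟨ cong (A i) (swap-fromℕ k) ⟨
      A i (swap (inject₁ k) (fromℕ (suc n)))          ∎) ⟩
    0ℚ                                              ∎
    where
    swap-suc : ∀ {n} (k : Fin n) → swap k (suc k) ≡ inject₁ k
    swap-suc zero    = refl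
    swap-suc (suc k) = cong suc (swap-suc k)

-- Dependence of the determinant on its last column

infixl 5 _∷ʳ_ _▹_

_∷ʳ_ : (Fin n → ℚ) → ℚ → Fin (suc n) → ℚ
_∷ʳ_ {zero}  v x zero    = x
_∷ʳ_ {suc n} v x zero    = v zero
_∷ʳ_ {suc n} v x (suc j) = ((v ∘ suc) ∷ʳ x) j

_▹_ : Matrix m n → (Fin m → ℚ) → Matrix m (suc n)
(A ▹ w) i = A i ∷ʳ w i

∷ʳ-inject₁ : (v : Fin n → ℚ) (x : ℚ) → ∀ j → (v ∷ʳ x) (inject₁ j) ≡ v j
∷ʳ-inject₁ v x zero    = refl
∷ʳ-inject₁ v x (suc j) = ∷ʳ-inject₁ (v ∘ suc) x j

∷ʳ-fromℕ : (v : Fin n → ℚ) (x : ℚ) → (v ∷ʳ x) (fromℕ n) ≡ x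
∷ʳ-fromℕ {zero}  v x = refl
∷ʳ-fromℕ {suc n} v x = ∷ʳ-fromℕ (v ∘ suc) x

∷ʳ-eta : (v : Fin (suc n) → ℚ) → ∀ j → (v ∘ inject₁ ∷ʳ v (fromℕ n)) j ≡ v j
∷ʳ-eta {zero}  v zero    = refl
∷ʳ-eta {suc n} v zero    = refl
∷ʳ-eta {suc n} v (suc j) = ∷ʳ-eta (v ∘ suc) j

∷ʳ-punchIn-inject₁ : (v : Fin (suc n) → ℚ) (x : ℚ) (j : Fin (suc n)) →
  ∀ k → (v ∷ʳ x) (punchIn (inject₁ j) k) ≡ (v ∘ punchIn j ∷ʳ x) k
∷ʳ-punchIn-inject₁ v x zero k = refl
∷ʳ-punchIn-inject₁ {suc n} v x (suc j) zero    = refl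
∷ʳ-punchIn-inject₁ {suc n} v x (suc j) (suc k) = ∷ʳ-punchIn-inject₁ (v ∘ suc) x j k

∷ʳ-punchIn-fromℕ : (v : Fin n → ℚ) (x : ℚ) → ∀ k → (v ∷ʳ x) (punchIn (fromℕ n) k) ≡ v k
∷ʳ-punchIn-fromℕ v x zero    = refl
∷ʳ-punchIn-fromℕ v x (suc k) = ∷ʳ-punchIn-fromℕ (v ∘ suc) x k

-- Every term but the last keeps `w` as the last column of a smaller matrix of the same form, which
-- sets up the inductions below; the minor in the last term is free of `w`.
det-▹-expand : (A : Matrix (suc (suc n)) (suc n)) (w : Fin (suc (suc n)) → ℚ) →
  det (A ▹ w) ≡ ∑ (λ j → sgn j * (A zero j * det ((λ i → A (suc i) ∘ punchIn j) ▹ w ∘ suc)))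
                + sgn (fromℕ (suc n)) * (w zero * det (A ∘ suc))
det-▹-expand {n} A w = begin
  ∑ (laplaceTerm (A ▹ w))
    ≡⟨ sum-init-last (laplaceTerm (A ▹ w)) ⟩
  ∑ (laplaceTerm (A ▹ w) ∘ inject₁) + laplaceTerm (A ▹ w) (fromℕ (suc n))
    ≡⟨ cong₂ _+_
         (sum-cong-≗ λ j → cong₂ _*_ (cong ((- 1ℚ) ^_) (toℕ-inject₁ j))
           (cong₂ _*_ (∷ʳ-inject₁ (A zero) (w zero) j)
             (det-cong λ i → ∷ʳ-punchIn-inject₁ (A (suc i)) (w (suc i)) j)))
         (cong (sgn (fromℕ (suc n)) *_) (cong₂ _*_ (∷ʳ-fromℕ (A zero) (w zero))
           (det-cong λ i → ∷ʳ-punchIn-fromℕ (A (suc i)) (w (suc i))))) ⟩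
  _ ∎

det-▹-linear : (A : Matrix (suc n) n) (c d : ℚ) (u w : Fin (suc n) → ℚ) →
  det (A ▹ λ i → c * u i + d * w i) ≡ c * det (A ▹ u) + d * det (A ▹ w)
det-▹-linear {zero} A c d u w =
  solve 4 (λ c d u w → con 1ℚ :* ((c :* u :+ d :* w) :* con 1ℚ) :+ con 0ℚ
     := c :* (con 1ℚ :* (u :* con 1ℚ) :+ con 0ℚ) :+ d :* (con 1ℚ :* (w :* con 1ℚ) :+ con 0ℚ))
    refl c d (u zero) (w zero)
det-▹-linear {suc n} A c d u w = begin
  det (A ▹ λ i → c * u i + d * w i)
    ≡⟨ det-▹-expand A (λ i → c * u i + d * w i) ⟩
  ∑ (λ j → sgn j * (A zero j * det (B j ▹ λ i → c * u (suc i) + d * w (suc i)))) + z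
    ≡⟨ cong (_+ z) (sum-cong-≗ λ j → begin
         sgn j * (A zero j * det (B j ▹ λ i → c * u (suc i) + d * w (suc i)))
           ≡⟨ cong (λ x → sgn j * (A zero j * x)) (det-▹-linear (B j) c d (u ∘ suc) (w ∘ suc)) ⟩
         sgn j * (A zero j * (c * det (B j ▹ u ∘ suc) + d * det (B j ▹ w ∘ suc)))
           ≡⟨ solve 6 (λ s a x c d y → s :* (a :* (c :* x :+ d :* y))
                := c :* (s :* (a :* x)) :+ d :* (s :* (a :* y))) refl
                (sgn j) (A zero j) (det (B j ▹ u ∘ suc)) c d (det (B j ▹ w ∘ suc)) ⟩
         c * t u j + d * t w j ∎) ⟩
  ∑ (λ j → c * t u j + d * t w j) + z
    ≡⟨ cong (_+ z) (trans (∑-distrib-+ (λ j → c * t u j) λ j → d * t w j)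
         (cong₂ _+_ (sym (*-distribˡ-sum c (t u))) (sym (*-distribˡ-sum d (t w))))) ⟩
  c * ∑ (t u) + d * ∑ (t w) + z
    ≡⟨ solve 8 (λ x c d y s u w e → c :* x :+ d :* y :+ s :* ((c :* u :+ d :* w) :* e)
         := c :* (x :+ s :* (u :* e)) :+ d :* (y :+ s :* (w :* e))) refl
         (∑ (t u)) c d (∑ (t w)) s (u zero) (w zero) (det (A ∘ suc)) ⟩
  c * (∑ (t u) + s * (u zero * det (A ∘ suc))) + d * (∑ (t w) + s * (w zero * det (A ∘ suc)))
    ≡⟨ cong₂ (λ x y → c * x + d * y) (det-▹-expand A u) (det-▹-expand A w) ⟨
  c * det (A ▹ u) + d * det (A ▹ w) ∎
  where
  s = sgn (fromℕ (suc n))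
  z = s * ((c * u zero + d * w zero) * det (A ∘ suc))
  B : Fin (suc n) → Matrix (suc n) n
  B j i = A (suc i) ∘ punchIn j
  t : (Fin (suc (suc n)) → ℚ) → Fin (suc n) → ℚ
  t u j = sgn j * (A zero j * det (B j ▹ u ∘ suc))

det-▹-repeated : (A : Matrix (suc n) n) (j : Fin n) → det (A ▹ λ i → A i j) ≡ 0ℚ
det-▹-repeated A j = det-repeatedLast j (A ▹ λ i → A i j) λ i →
  trans (∷ʳ-inject₁ (A i) (A i j) j) (sym (∷ʳ-fromℕ (A i) (A i j)))

-- Induction along the first row: the last term has the factor `w zero`, and each other term leaves
-- a smaller matrix whose last column has the same zeros. The corner lies on the diagonal, so no
-- sign appears.
det-▹-corner : (A : Matrix (suc n) n) (w : Fin (suc n) → ℚ) →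
  (∀ i → w (inject₁ i) ≡ 0ℚ) → det (A ▹ w) ≡ w (fromℕ n) * det (A ∘ inject₁)
det-▹-corner {zero} A w w≡0 = solve 1 (λ x → con 1ℚ :* (x :* con 1ℚ) :+ con 0ℚ := x :* con 1ℚ) refl (w zero)
det-▹-corner {suc n} A w w≡0 = begin
  det (A ▹ w)
    ≡⟨ det-▹-expand A w ⟩
  ∑ (λ j → sgn j * (A zero j * det (B j ▹ w ∘ suc))) + s * (w zero * d)
    ≡⟨ cong₂ _+_ (sum-cong-≗ λ j → begin
         sgn j * (A zero j * det (B j ▹ w ∘ suc))
           ≡⟨ cong (λ x → sgn j * (A zero j * x)) (det-▹-corner (B j) (w ∘ suc) (w≡0 ∘ suc)) ⟩
         sgn j * (A zero j * (h * det (B j ∘ inject₁)))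
           ≡⟨ solve 4 (λ s a h d → s :* (a :* (h :* d)) := h :* (s :* (a :* d))) refl
                (sgn j) (A zero j) h (det (B j ∘ inject₁)) ⟩
         h * laplaceTerm (A ∘ inject₁) j ∎)
       (cong (λ x → s * (x * d)) (w≡0 zero)) ⟩
  ∑ (λ j → h * laplaceTerm (A ∘ inject₁) j) + s * (0ℚ * d)
    ≡⟨ cong₂ _+_ (sym (*-distribˡ-sum h (laplaceTerm (A ∘ inject₁)))) (solve 2 (λ s d → s :* (con 0ℚ :* d) := con 0ℚ) refl s d) ⟩
  h * det (A ∘ inject₁) + 0ℚ
    ≡⟨ +-identityʳ _ ⟩
  h * det (A ∘ inject₁) ∎
  where
  s = sgn (fromℕ (suc n))
  d = det (A ∘ suc)
  h = w (fromℕ (suc n))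
  B : Fin (suc n) → Matrix (suc n) n
  B j i = A (suc i) ∘ punchIn j

-- Rational numbers

fromℕᵘ : ℕ → ℚᵘ.ℚᵘ
fromℕᵘ n = mkℚᵘ (ℤ.+ n) 0

ι : ℕ → ℚ
ι n = ℤ.+ n / 1

ι≃ : ∀ n → toℚᵘ (ι n) ℚᵘ.≃ fromℕᵘ n
ι≃ n = toℚᵘ-fromℚᵘ (fromℕᵘ n)

-- `/` normalises its result, so the identity is transported to unnormalised fractions, where it
-- reduces to one between integers.
ι-+ : ∀ m n → ι (m ℕ.+ n) ≡ ι m + ι n
ι-+ m n = toℚᵘ-injective (begin′
  toℚᵘ (ι (m ℕ.+ n))          ≈⟨ ι≃ (m ℕ.+ n) ⟩
  fromℕᵘ (m ℕ.+ n)            ≈⟨ *≡* (cong (λ k → k ℤ.* ℤ.+ 1) (cong₂ ℤ._+_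
                                   (sym (ℤ.*-identityʳ (ℤ.+ m))) (sym (ℤ.*-identityʳ (ℤ.+ n))))) ⟩
  fromℕᵘ m ℚᵘ.+ fromℕᵘ n      ≈⟨ ℚᵘ.+-cong (ι≃ m) (ι≃ n) ⟨
  toℚᵘ (ι m) ℚᵘ.+ toℚᵘ (ι n)  ≈⟨ toℚᵘ-homo-+ (ι m) (ι n) ⟨
  toℚᵘ (ι m + ι n)            ∎′)
  where open ℚᵘ.≃-Reasoning renaming (begin_ to begin′_; _∎ to _∎′)

ι-* : ∀ m n → ι (m ℕ.* n) ≡ ι m * ι n
ι-* m n = toℚᵘ-injective (begin′
  toℚᵘ (ι (m ℕ.* n))          ≈⟨ ι≃ (m ℕ.* n) ⟩
  fromℕᵘ (m ℕ.* n)            ≈⟨ *≡* (cong (λ k → k ℤ.* ℤ.+ 1) (ℤ.pos-* m n)) ⟩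
  fromℕᵘ m ℚᵘ.* fromℕᵘ n      ≈⟨ ℚᵘ.*-cong (ι≃ m) (ι≃ n) ⟨
  toℚᵘ (ι m) ℚᵘ.* toℚᵘ (ι n)  ≈⟨ toℚᵘ-homo-* (ι m) (ι n) ⟨
  toℚᵘ (ι m * ι n)            ∎′)
  where open ℚᵘ.≃-Reasoning renaming (begin_ to begin′_; _∎ to _∎′)

ι-suc : ∀ n → ι (suc n) ≡ ι n + 1ℚ
ι-suc n = trans (ι-+ 1 n) (+-comm 1ℚ (ι n))

ι-cancel : ∀ i d .{{_ : ℕ.NonZero d}} → ι d * (i / d) ≡ i / 1
ι-cancel i d@(suc d-1) = toℚᵘ-injective (begin′
  toℚᵘ (ι d * (i / d))          ≈⟨ toℚᵘ-homo-* (ι d) (i / d) ⟩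
  toℚᵘ (ι d) ℚᵘ.* toℚᵘ (i / d)  ≈⟨ ℚᵘ.*-cong (ι≃ d) (toℚᵘ-fromℚᵘ (mkℚᵘ i d-1)) ⟩
  fromℕᵘ d ℚᵘ.* mkℚᵘ i d-1      ≈⟨ *≡* (trans (ℤ.*-identityʳ (ℤ.+ d ℤ.* i)) (trans (ℤ.*-comm (ℤ.+ d) i)
                                     (cong (λ k → i ℤ.* ℤ.+ k) (sym (ℕ.+-identityʳ d))))) ⟩
  mkℚᵘ i 0                      ≈⟨ toℚᵘ-fromℚᵘ (mkℚᵘ i 0) ⟨
  toℚᵘ (i / 1)                  ∎′)
  where open ℚᵘ.≃-Reasoning renaming (begin_ to begin′_; _∎ to _∎′)

neg-/1 : ∀ i → (ℤ.- i) / 1 ≡ - (i / 1)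
neg-/1 (ℤ.+ zero)   = refl
neg-/1 (ℤ.+ suc n)  = refl
neg-/1 (ℤ.-[1+ n ]) = solve 1 (λ x → x := :- :- x) refl (ι (suc n))


2ℚ : ℚ
2ℚ = 1ℚ + 1ℚ

*-cancelˡ-≢0 : ∀ {p q r} → p ≢ 0ℚ → p * q ≡ p * r → q ≡ r
*-cancelˡ-≢0 {p} {q} {r} p≢0 pq≡pr = begin
  q              ≡⟨ *-identityˡ q ⟨
  1ℚ * q         ≡⟨ cong (_* q) (*-inverseˡ p) ⟨
  1/p * p * q    ≡⟨ *-assoc 1/p p q ⟩
  1/p * (p * q)  ≡⟨ cong (1/p *_) pq≡pr ⟩
  1/p * (p * r)  ≡⟨ *-assoc 1/p p r ⟨
  1/p * p * r    ≡⟨ cong (_* r) (*-inverseˡ p) ⟩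
  1ℚ * r         ≡⟨ *-identityˡ r ⟩
  r              ∎
  where
  instance
    _ : NonZero p
    _ = ≢-nonZero p≢0
  1/p = 1/ p

ι≢0 : ∀ n .{{_ : ℕ.NonZero n}} → ι n ≢ 0ℚ
ι≢0 n ιn≡0 = contradiction (begin
  1ℚ                     ≡⟨ ι-cancel (ℤ.+ 1) n ⟨
  ι n * (ℤ.+ 1 / n)      ≡⟨ cong (_* (ℤ.+ 1 / n)) ιn≡0 ⟩
  0ℚ * (ℤ.+ 1 / n)       ≡⟨ *-zeroˡ (ℤ.+ 1 / n) ⟩
  0ℚ                     ∎) λ ()

ι-double : ∀ n → ι (2 ℕ.* n) ≡ 2ℚ * ι n
ι-double n = ι-* 2 n

ι-^ : ∀ m k → ι (m ℕ.^ k) ≡ ι m ^ k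
ι-^ m zero    = refl
ι-^ m (suc k) = trans (ι-* m (m ℕ.^ k)) (cong (ι m *_) (ι-^ m k))

-- Power series and their derivatives at 0

D : Series → Series
D h n = ι (suc n) * h (suc n)

-- The derivatives of the series `h` at 0; `a` is `ev f` by computation.
ev : Series → Series
ev h n = ι (n !) * h n

infixl 7 _⋆_

-- The product of series on the level of derivatives at 0: ev (g ⊛ h) = ev g ⋆ ev h.
_⋆_ : Series → Series → Series
(u ⋆ v) zero    = u zero * v zero
(u ⋆ v) (suc n) = (u ∘ suc ⋆ v) n + (u ⋆ v ∘ suc) n

⋆-cong : ∀ {u u′ v v′ : Series} → u ≗ u′ → v ≗ v′ → u ⋆ v ≗ u′ ⋆ v′
⋆-cong u≗ v≗ zero    = cong₂ _*_ (u≗ 0) (v≗ 0)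
⋆-cong u≗ v≗ (suc n) = cong₂ _+_ (⋆-cong (u≗ ∘ suc) v≗ n) (⋆-cong u≗ (v≗ ∘ suc) n)

⋆-linearʳ : ∀ u c v w n → (u ⋆ λ k → v k + c * w k) n ≡ (u ⋆ v) n + c * (u ⋆ w) n
⋆-linearʳ u c v w zero    = solve 4 (λ u c v w → u :* (v :+ c :* w) := u :* v :+ c :* (u :* w)) refl (u 0) c (v 0) (w 0)
⋆-linearʳ u c v w (suc n) = trans
  (cong₂ _+_ (⋆-linearʳ (u ∘ suc) c v w n) (⋆-linearʳ u c (v ∘ suc) (w ∘ suc) n))
  (solve 5 (λ p q r s c → p :+ c :* q :+ (r :+ c :* s) := p :+ r :+ c :* (q :+ s)) refl
    ((u ∘ suc ⋆ v) n) ((u ∘ suc ⋆ w) n) ((u ⋆ v ∘ suc) n) ((u ⋆ w ∘ suc) n) c)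

⋆-negˡ : ∀ u v n → ((λ k → - u k) ⋆ v) n ≡ - (u ⋆ v) n
⋆-negˡ u v zero    = sym (neg-distribˡ-* (u 0) (v 0))
⋆-negˡ u v (suc n) = trans
  (cong₂ _+_ (⋆-negˡ (u ∘ suc) v n) (⋆-negˡ u (v ∘ suc) n))
  (sym (neg-distrib-+ ((u ∘ suc ⋆ v) n) ((u ⋆ v ∘ suc) n)))

-- `⊛` splits off its first summand by computation; this is the mirror image, for use when the
-- second factor is the one that shifts.
⊛-sucʳ : ∀ g h n → (g ⊛ h) (suc n) ≡ (g ⊛ h ∘ suc) n + g (suc n) * h 0
⊛-sucʳ g h zero    = solve 4 (λ a b c d → a :* b :+ (c :* d :+ con 0ℚ) := a :* b :+ con 0ℚ :+ c :* d) refl (g 0) (h 1) (g 1) (h 0)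
⊛-sucʳ g h (suc n) = trans
  (cong (g 0 * h (suc (suc n)) +_) (⊛-sucʳ (g ∘ suc) h n))
  (sym (+-assoc (g 0 * h (suc (suc n))) ((g ∘ suc ⊛ h ∘ suc) n) (g (suc (suc n)) * h 0)))

-- Writing n + 1 = i + (n + 1 - i) in each summand gives the product rule for x d/dx, called `θ`
-- below. Its values are those of `D` moved up by one degree, with constant term 0.
leibniz : ∀ g h n → D (g ⊛ h) n ≡ (D g ⊛ h) n + (g ⊛ D h) n
leibniz g h n = begin
  ι (suc n) * (g ⊛ h) (suc n)
    ≡⟨ *-distribˡ-sum (ι (suc n)) t ⟩
  ∑ (λ i → ι (suc n) * t i)
    ≡⟨ sum-cong-≗ {suc (suc n)} split ⟩
  ∑ {suc (suc n)} (λ i → θ g (toℕ i) * h (suc n ∸ toℕ i) + g (toℕ i) * θ h (suc n ∸ toℕ i))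
    ≡⟨ ∑-distrib-+ {suc (suc n)} (λ i → θ g (toℕ i) * h (suc n ∸ toℕ i)) (λ i → g (toℕ i) * θ h (suc n ∸ toℕ i)) ⟩
  (θ g ⊛ h) (suc n) + (g ⊛ θ h) (suc n)
    ≡⟨ cong ((θ g ⊛ h) (suc n) +_) (⊛-sucʳ g (θ h) n) ⟩
  0ℚ * g 0 * h (suc n) + (D g ⊛ h) n + ((g ⊛ D h) n + g (suc n) * (0ℚ * h 0))
    ≡⟨ solve 6 (λ a b x y c d → con 0ℚ :* a :* b :+ x :+ (y :+ c :* (con 0ℚ :* d)) := x :+ y) refl
         (g 0) (h (suc n)) ((D g ⊛ h) n) ((g ⊛ D h) n) (g (suc n)) (h 0) ⟩
  (D g ⊛ h) n + (g ⊛ D h) n ∎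
  where
  θ : Series → Series
  θ h n = ι n * h n
  t : Fin (suc (suc n)) → ℚ
  t i = g (toℕ i) * h (suc n ∸ toℕ i)
  split : ∀ i → ι (suc n) * t i ≡ θ g (toℕ i) * h (suc n ∸ toℕ i) + g (toℕ i) * θ h (suc n ∸ toℕ i)
  split i = begin
    ι (suc n) * t i
      ≡⟨ cong (λ m → ι m * t i) (ℕ.m+[n∸m]≡n (toℕ≤pred[n] i)) ⟨
    ι (toℕ i ℕ.+ (suc n ∸ toℕ i)) * t i
      ≡⟨ cong (_* t i) (ι-+ (toℕ i) (suc n ∸ toℕ i)) ⟩
    (ι (toℕ i) + ι (suc n ∸ toℕ i)) * t i
      ≡⟨ solve 4 (λ p q x y → (p :+ q) :* (x :* y) := p :* x :* y :+ x :* (q :* y)) refl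
           (ι (toℕ i)) (ι (suc n ∸ toℕ i)) (g (toℕ i)) (h (suc n ∸ toℕ i)) ⟩
    θ g (toℕ i) * h (suc n ∸ toℕ i) + g (toℕ i) * θ h (suc n ∸ toℕ i) ∎

ev-D : ∀ h n → ev (D h) n ≡ ev h (suc n)
ev-D h n = begin
  ι (n !) * (ι (suc n) * h (suc n))  ≡⟨ solve 3 (λ x y z → x :* (y :* z) := y :* x :* z) refl (ι (n !)) (ι (suc n)) (h (suc n)) ⟩
  ι (suc n) * ι (n !) * h (suc n)    ≡⟨ cong (_* h (suc n)) (ι-* (suc n) (n !)) ⟨
  ι (suc n !) * h (suc n)            ∎

ev-⊛ : ∀ g h n → ev (g ⊛ h) n ≡ (ev g ⋆ ev h) n
ev-⊛ g h zero    = solve 2 (λ x y → con 1ℚ :* (x :* y :+ con 0ℚ) := con 1ℚ :* x :* (con 1ℚ :* y)) refl (g 0) (h 0)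
ev-⊛ g h (suc n) = begin
  ev (g ⊛ h) (suc n)                         ≡⟨ ev-D (g ⊛ h) n ⟨
  ι (n !) * D (g ⊛ h) n                      ≡⟨ cong (ι (n !) *_) (leibniz g h n) ⟩
  ι (n !) * ((D g ⊛ h) n + (g ⊛ D h) n)      ≡⟨ *-distribˡ-+ (ι (n !)) ((D g ⊛ h) n) ((g ⊛ D h) n) ⟩
  ev (D g ⊛ h) n + ev (g ⊛ D h) n            ≡⟨ cong₂ _+_ (ev-⊛ (D g) h n) (ev-⊛ g (D h) n) ⟩
  (ev (D g) ⋆ ev h) n + (ev g ⋆ ev (D h)) n  ≡⟨ cong₂ _+_ (⋆-cong (ev-D g) (λ _ → refl) n) (⋆-cong {u = ev g} (λ _ → refl) (ev-D h) n) ⟩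
  (ev g ⋆ ev h) (suc n)                      ∎

-- The equation sin · f = x + x² in terms of derivatives at 0

Sin Cos : Series
Sin n = sin⁽ n ⁾0 / 1
Cos n = Sin (suc n)

ev-sin : ev sin ≗ Sin
ev-sin n = ι-cancel (sin⁽ n ⁾0) (n !) {{n ℕ.!≢0}}

Cos-suc : ∀ n → Cos (suc n) ≡ - Sin n
Cos-suc n = neg-/1 (sin⁽ n ⁾0)

infix 8 X·_

X·_ : Series → Series
(X· h) zero    = 0ℚ
(X· h) (suc n) = h n

f≗ : ∀ n → f n ≡ X/sinX n + (X· X/sinX) n
f≗ n = lemma X/sinX n
  where
  lemma : ∀ h n → (1+X ⊛ h) n ≡ h n + (X· h) n
  lemma h zero          = solve 1 (λ x → con 1ℚ :* x :+ con 0ℚ := x :+ con 0ℚ) refl (h 0)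
  lemma h (suc zero)    = solve 2 (λ x y → con 1ℚ :* x :+ (con 1ℚ :* y :+ con 0ℚ) := x :+ y) refl (h 1) (h 0)
  lemma h (suc (suc n)) = begin
    1ℚ * x + (1ℚ * y + ∑ z)  ≡⟨ cong (λ z → 1ℚ * x + (1ℚ * y + z)) (∑-zero {t = z} λ i → *-zeroˡ (h (n ∸ toℕ i))) ⟩
    1ℚ * x + (1ℚ * y + 0ℚ)   ≡⟨ solve 2 (λ x y → con 1ℚ :* x :+ (con 1ℚ :* y :+ con 0ℚ) := x :+ y) refl x y ⟩
    x + y                    ∎
    where
    x = h (suc (suc n))
    y = h (suc n)
    z : Fin (suc n) → ℚ
    z i = 1+X (suc (suc (toℕ i))) * h (n ∸ toℕ i)

sin⊛f : ∀ n → (sin ⊛ f) n ≡ X n + (X· X) n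
sin⊛f n = begin
  (sin ⊛ f) n
    ≡⟨ sum-cong-≗ {suc n} (λ i → trans (cong (sin (toℕ i) *_) (f≗ (n ∸ toℕ i)))
         (*-distribˡ-+ (sin (toℕ i)) (X/sinX (n ∸ toℕ i)) ((X· X/sinX) (n ∸ toℕ i)))) ⟩
  ∑ (λ (i : Fin (suc n)) → sin (toℕ i) * X/sinX (n ∸ toℕ i) + sin (toℕ i) * (X· X/sinX) (n ∸ toℕ i))
    ≡⟨ ∑-distrib-+ {suc n} (λ i → sin (toℕ i) * X/sinX (n ∸ toℕ i)) (λ i → sin (toℕ i) * (X· X/sinX) (n ∸ toℕ i)) ⟩
  (sin ⊛ X/sinX) n + (sin ⊛ X· X/sinX) n
    ≡⟨ cong₂ _+_ (sin⊛X/sinX n) (shifted n) ⟩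
  X n + (X· X) n ∎
  where
  shifted : ∀ n → (sin ⊛ X· X/sinX) n ≡ (X· X) n
  shifted zero    = refl
  shifted (suc n) = begin
    (sin ⊛ X· X/sinX) (suc n)                  ≡⟨ ⊛-sucʳ sin (X· X/sinX) n ⟩
    (sin ⊛ X/sinX) n + sin (suc n) * 0ℚ        ≡⟨ cong₂ _+_ (sin⊛X/sinX n) (*-zeroʳ (sin (suc n))) ⟩
    X n + 0ℚ                                   ≡⟨ +-identityʳ (X n) ⟩
    X n                                        ∎

-- The derivatives of x + x² at 0.
Y : Series
Y 1 = 1ℚ
Y 2 = 2ℚ
Y _ = 0ℚ

Sin⋆a : Sin ⋆ a ≗ Y
Sin⋆a n = begin
  (Sin ⋆ a) n              ≡⟨ ⋆-cong ev-sin (λ _ → refl) n ⟨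
  (ev sin ⋆ ev f) n        ≡⟨ ev-⊛ sin f n ⟨
  ev (sin ⊛ f) n           ≡⟨ cong (ι (n !) *_) (sin⊛f n) ⟩
  ι (n !) * (X n + (X· X) n) ≡⟨ eval n ⟩
  Y n                      ∎
  where
  eval : ∀ n → ι (n !) * (X n + (X· X) n) ≡ Y n
  eval 0 = refl
  eval 1 = refl
  eval 2 = refl
  eval (suc (suc (suc n))) = *-zeroʳ (ι (suc (suc (suc n)) !))

-- The operators φᵢ and ψᵢ

odd even : ℕ → ℚ
odd  i = 2ℚ * ι i + 1ℚ
even i = 2ℚ * ι i + 2ℚ

-- On b = ev h, Φ i acts as φᵢ and Ψ i as ψᵢ do on h, since ev turns D into the shift.
Φ Ψ : ℕ → Series → Series
Φ zero    b   = b
Φ (suc i) b k = Φ i b (suc (suc k)) + odd i * odd i * Φ i b k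
Ψ zero    b k = b (suc k)
Ψ (suc i) b k = Ψ i b (suc (suc k)) + even i * even i * Ψ i b k

Ψ-cong : ∀ i {b b′ : Series} → b ≗ b′ → Ψ i b ≗ Ψ i b′
Ψ-cong zero    b≗ k = b≗ (suc k)
Ψ-cong (suc i) b≗ k = cong₂ (λ x y → x + even i * even i * y)
  (Ψ-cong i b≗ (suc (suc k))) (Ψ-cong i b≗ k)

-- Put o = 2i + 1. Applying D² + (o + 1)² to the right side for i gives sin · D³φᵢh, and the
-- coefficients (o + 1)² - 1 - 2o = o² of sin · Dφᵢh, o + 2 of cos · D²φᵢh and o((o + 1)² - 1) = (o
-- + 2)o² of cos · φᵢh, which regroup into φ at i + 1.
Ψ-Sin⋆ : ∀ i h n → Ψ i (Sin ⋆ h) n ≡ (Sin ⋆ Φ i h ∘ suc) n + odd i * (Cos ⋆ Φ i h) n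
Ψ-Sin⋆ zero h n = solve 2 (λ x y → x :+ y := y :+ con 1ℚ :* x) refl ((Cos ⋆ h) n) ((Sin ⋆ h ∘ suc) n)
Ψ-Sin⋆ (suc i) h n = begin
  Ψ i (Sin ⋆ h) (suc (suc n)) + even i * even i * Ψ i (Sin ⋆ h) n
    ≡⟨ cong₂ (λ x y → x + even i * even i * y) (Ψ-Sin⋆ i h (suc (suc n))) (Ψ-Sin⋆ i h n) ⟩
  (c₁ ⋆ u₁) n + (Cos ⋆ u₂) n + ((Cos ⋆ u₂) n + (Sin ⋆ u₃) n)
    + odd i * ((c₂ ⋆ u) n + (c₁ ⋆ u₁) n + ((c₁ ⋆ u₁) n + (Cos ⋆ u₂) n))
    + even i * even i * ((Sin ⋆ u₁) n + odd i * (Cos ⋆ u) n)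
    ≡⟨ cong₂ (λ x y → x + (Cos ⋆ u₂) n + ((Cos ⋆ u₂) n + (Sin ⋆ u₃) n)
         + odd i * (y + x + (x + (Cos ⋆ u₂) n))
         + even i * even i * ((Sin ⋆ u₁) n + odd i * (Cos ⋆ u) n))
         (trans (⋆-cong {v = u₁} Cos-suc (λ _ → refl) n) (⋆-negˡ Sin u₁ n))
         (trans (⋆-cong {v = u} (λ k → Cos-suc (suc k)) (λ _ → refl) n) (⋆-negˡ Cos u n)) ⟩
  - (Sin ⋆ u₁) n + (Cos ⋆ u₂) n + ((Cos ⋆ u₂) n + (Sin ⋆ u₃) n)
    + odd i * (- (Cos ⋆ u) n + - (Sin ⋆ u₁) n + (- (Sin ⋆ u₁) n + (Cos ⋆ u₂) n))
    + even i * even i * ((Sin ⋆ u₁) n + odd i * (Cos ⋆ u) n)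
    ≡⟨ solve 5 (λ I s c s₃ c₂ →
         let o = con 2ℚ :* I :+ con 1ℚ
             e = con 2ℚ :* I :+ con 2ℚ
             o′ = con 2ℚ :* (I :+ con 1ℚ) :+ con 1ℚ in
         :- s :+ c₂ :+ (c₂ :+ s₃) :+ o :* (:- c :+ :- s :+ (:- s :+ c₂)) :+ e :* e :* (s :+ o :* c)
         := s₃ :+ o :* o :* s :+ o′ :* (c₂ :+ o :* o :* c)) refl
         (ι i) ((Sin ⋆ u₁) n) ((Cos ⋆ u) n) ((Sin ⋆ u₃) n) ((Cos ⋆ u₂) n) ⟩
  (Sin ⋆ u₃) n + odd i * odd i * (Sin ⋆ u₁) n
    + (2ℚ * (ι i + 1ℚ) + 1ℚ) * ((Cos ⋆ u₂) n + odd i * odd i * (Cos ⋆ u) n)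
    ≡⟨ cong₂ (λ x y → x + (2ℚ * (ι i + 1ℚ) + 1ℚ) * y) (⋆-linearʳ Sin (odd i * odd i) u₃ u₁ n) (⋆-linearʳ Cos (odd i * odd i) u₂ u n) ⟨
  (Sin ⋆ Φ (suc i) h ∘ suc) n + (2ℚ * (ι i + 1ℚ) + 1ℚ) * (Cos ⋆ Φ (suc i) h) n
    ≡⟨ cong (λ x → (Sin ⋆ Φ (suc i) h ∘ suc) n + (2ℚ * x + 1ℚ) * (Cos ⋆ Φ (suc i) h) n) (ι-suc i) ⟨
  (Sin ⋆ Φ (suc i) h ∘ suc) n + odd (suc i) * (Cos ⋆ Φ (suc i) h) n ∎
  where
  u = Φ i h
  u₁ = u ∘ suc
  c₁ c₂ : Series
  c₁ = Cos ∘ suc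
  c₂ = c₁ ∘ suc
  u₂ = u₁ ∘ suc
  u₃ = u₂ ∘ suc

-- The product of (2l)² over 1 ≤ l ≤ i, that is 4^i (i!)².
c : ℕ → ℚ
c zero    = 1ℚ
c (suc i) = even i * even i * c i

-- D² annihilates D(x + x²) = 1 + 2x, so each factor D² + (2l)² of ψᵢ acts as the scalar (2l)².
Ψ-Y : ∀ i n → Ψ i Y n ≡ c i * Y (suc n)
Ψ-Y zero    n = sym (*-identityˡ (Y (suc n)))
Ψ-Y (suc i) n = trans (cong₂ (λ x y → x + even i * even i * y) (Ψ-Y i (suc (suc n))) (Ψ-Y i n))
  (solve 3 (λ c e y → c :* con 0ℚ :+ e :* e :* (c :* y) := e :* e :* c :* y) refl (c i) (even i) (Y (suc n)))

Ψ-Sin⋆a : ∀ i n → (Sin ⋆ Φ i a ∘ suc) n + odd i * (Cos ⋆ Φ i a) n ≡ c i * Y (suc n)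
Ψ-Sin⋆a i n = trans (sym (Ψ-Sin⋆ i a n)) (trans (Ψ-cong i Sin⋆a n) (Ψ-Y i n))

-- At order 0 only the cosine term survives.
Φ-a₀ : ∀ i → odd i * Φ i a 0 ≡ c i
Φ-a₀ i = begin
  odd i * Φ i a 0
    ≡⟨ solve 3 (λ o x y → o :* x := con 0ℚ :* y :+ o :* (con 1ℚ :* x)) refl (odd i) (Φ i a 0) (Φ i a 1) ⟩
  0ℚ * Φ i a 1 + odd i * (1ℚ * Φ i a 0)
    ≡⟨ Ψ-Sin⋆a i 0 ⟩
  c i * 1ℚ
    ≡⟨ *-identityʳ (c i) ⟩
  c i ∎

-- At order 1 the sine term contributes `Φ i a 1` once and the cosine term 2i + 1 times.
Φ-a₁ : ∀ i → even i * Φ i a 1 ≡ c i * 2ℚ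
Φ-a₁ i = begin
  even i * Φ i a 1
    ≡⟨ solve 4 (λ I x y z → let o = con 2ℚ :* I :+ con 1ℚ ; e = con 2ℚ :* I :+ con 2ℚ in
         e :* y := con 1ℚ :* y :+ con 0ℚ :* z :+ o :* (con 0ℚ :* x :+ con 1ℚ :* y)) refl
         (ι i) (Φ i a 0) (Φ i a 1) (Φ i a 2) ⟩
  1ℚ * Φ i a 1 + 0ℚ * Φ i a 2 + odd i * (0ℚ * Φ i a 0 + 1ℚ * Φ i a 1)
    ≡⟨ Ψ-Sin⋆a i 1 ⟩
  c i * 2ℚ ∎

-- The moments and their elimination

Φ-linear : ∀ i p q b b′ n → Φ i (λ k → p * b k + q * b′ k) n ≡ p * Φ i b n + q * Φ i b′ n
Φ-linear zero    p q b b′ n = refl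
Φ-linear (suc i) p q b b′ n = trans
  (cong₂ (λ x y → x + odd i * odd i * y) (Φ-linear i p q b b′ (suc (suc n))) (Φ-linear i p q b b′ n))
  (solve 7 (λ p q x y x′ y′ o → p :* x :+ q :* x′ :+ o :* o :* (p :* y :+ q :* y′)
      := p :* (x :+ o :* o :* y) :+ q :* (x′ :+ o :* o :* y′)) refl
    p q (Φ i b (suc (suc n))) (Φ i b n) (Φ i b′ (suc (suc n))) (Φ i b′ n) (odd i))

Φ-shift : ∀ i b n → Φ i (b ∘ suc) n ≡ Φ i b (suc n)
Φ-shift zero    b n = refl
Φ-shift (suc i) b n = cong₂ (λ x y → x + odd i * odd i * y) (Φ-shift i b (suc (suc n))) (Φ-shift i b n)

1/suc : ℕ → ℚ
1/suc m = ℤ.+ 1 / suc m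

-- ξ_m f, scaled so that the factor of (φᵢ ξ_m f)(0) depending on m alone becomes 1.
Z : ℕ → Series
Z zero            = a
Z (suc zero)    k = ½ * a (suc k) + 0ℚ * a (suc k)
Z (suc (suc m)) k = 1/suc m * 1/suc m * Z m (suc (suc k)) + 1/suc m * 1/suc m * (ι m * ι m) * Z m k

1/suc-inverse : ∀ m → (ι m + 1ℚ) * 1/suc m ≡ 1ℚ
1/suc-inverse m = trans (cong (_* 1/suc m) (sym (ι-suc m))) (ι-cancel (ℤ.+ 1) (suc m))

-- The denominators of the Cauchy matrix.
pivot : ℕ → ℕ → ℚ
pivot i m = 2ℚ * ι i + ι m + 1ℚ

-- Induction from m to m + 2. Since φᵢD² is φ at i + 1 minus (2i + 1)²φᵢ, the new moment combines
-- the moments of `Z m` at i + 1 and at i. The numerators add up by (2i + 2)² + ((m + 1) + (2i +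
-- 2))((m + 1) - (2i + 2)) = (m + 1)², which the scaling of `Z` cancels.
Φ-Z : ∀ m i → pivot i m * Φ i (Z m) 0 ≡ c i
Φ-Z zero i = trans
  (cong (_* Φ i a 0) (solve 1 (λ I → con 2ℚ :* I :+ con 0ℚ :+ con 1ℚ := con 2ℚ :* I :+ con 1ℚ) refl (ι i)))
  (Φ-a₀ i)
Φ-Z (suc zero) i = begin
  pivot i 1 * Φ i (Z 1) 0
    ≡⟨ cong (pivot i 1 *_) (Φ-linear i ½ 0ℚ (a ∘ suc) (a ∘ suc) 0) ⟩
  pivot i 1 * (½ * Φ i (a ∘ suc) 0 + 0ℚ * Φ i (a ∘ suc) 0)
    ≡⟨ solve 2 (λ I x → (con 2ℚ :* I :+ con 1ℚ :+ con 1ℚ) :* (con ½ :* x :+ con 0ℚ :* x)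
         := con ½ :* ((con 2ℚ :* I :+ con 2ℚ) :* x)) refl (ι i) (Φ i (a ∘ suc) 0) ⟩
  ½ * (even i * Φ i (a ∘ suc) 0)
    ≡⟨ cong (λ x → ½ * (even i * x)) (Φ-shift i a 0) ⟩
  ½ * (even i * Φ i a 1)
    ≡⟨ cong (½ *_) (Φ-a₁ i) ⟩
  ½ * (c i * 2ℚ)
    ≡⟨ solve 1 (λ c → con ½ :* (c :* con 2ℚ) := c) refl (c i) ⟩
  c i ∎
Φ-Z (suc (suc m)) i = begin
  pivot i (suc (suc m)) * Φ i (Z (suc (suc m))) 0
    ≡⟨ cong₂ _*_ (cong (λ x → 2ℚ * ι i + x + 1ℚ) (trans (ι-suc (suc m)) (cong (_+ 1ℚ) (ι-suc m))))
         (trans (Φ-linear i (s * s) (s * s * (M * M)) z₂ (Z m) 0)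
           (cong (λ t → s * s * t + s * s * (M * M) * y)
             (trans (Φ-shift i z₁ 0) (Φ-shift i (Z m) 1)))) ⟩
  (2ℚ * I + (M + 1ℚ + 1ℚ) + 1ℚ) * (s * s * x + s * s * (M * M) * y)
    ≡⟨ solve 5 (λ I M s x y →
         let o = con 2ℚ :* I :+ con 1ℚ in
         (con 2ℚ :* I :+ (M :+ con 1ℚ :+ con 1ℚ) :+ con 1ℚ) :* (s :* s :* x :+ s :* s :* (M :* M) :* y)
         := s :* s :* ((con 2ℚ :* (I :+ con 1ℚ) :+ M :+ con 1ℚ) :* (x :+ o :* o :* y)
            :+ (con 2ℚ :* I :+ M :+ con (2ℚ + 1ℚ)) :* (M :- con 2ℚ :* I :- con 1ℚ)
               :* ((con 2ℚ :* I :+ M :+ con 1ℚ) :* y))) refl I M s x y ⟩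
  s * s * ((2ℚ * (I + 1ℚ) + M + 1ℚ) * (x + odd i * odd i * y)
    + (2ℚ * I + M + (2ℚ + 1ℚ)) * (M - 2ℚ * I - 1ℚ) * (pivot i m * y))
    ≡⟨ cong₂ (λ p q → s * s * (p + (2ℚ * I + M + (2ℚ + 1ℚ)) * (M - 2ℚ * I - 1ℚ) * q))
         (trans (cong (λ t → (2ℚ * t + M + 1ℚ) * (x + odd i * odd i * y)) (sym (ι-suc i))) (Φ-Z m (suc i)))
         (Φ-Z m i) ⟩
  s * s * (even i * even i * c i + (2ℚ * I + M + (2ℚ + 1ℚ)) * (M - 2ℚ * I - 1ℚ) * c i)
    ≡⟨ solve 4 (λ I M s c →
         let e = con 2ℚ :* I :+ con 2ℚ in
         s :* s :* (e :* e :* c :+ (con 2ℚ :* I :+ M :+ con (2ℚ + 1ℚ)) :* (M :- con 2ℚ :* I :- con 1ℚ) :* c)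
         := (M :+ con 1ℚ) :* s :* ((M :+ con 1ℚ) :* s) :* c) refl I M s (c i) ⟩
  (M + 1ℚ) * s * ((M + 1ℚ) * s) * c i
    ≡⟨ cong (λ t → t * t * c i) (1/suc-inverse m) ⟩
  1ℚ * 1ℚ * c i
    ≡⟨ *-identityˡ (c i) ⟩
  c i ∎
  where
  I = ι i
  M = ι m
  s = 1/suc m
  z₁ z₂ : Series
  z₁ = Z m ∘ suc
  z₂ = z₁ ∘ suc
  x = Φ i (Z m) 2
  y = Φ i (Z m) 0

α β : ℕ → ℕ → ℚ
α k m = (2ℚ + 1ℚ) * ι k + ι m + 2ℚ
β k m = 2ℚ * ι k + ι m + 1ℚ

-- α and β make the combination vanish at i = k, as
-- α k m (x + m) - β k m (x + m + k + 1) = (k + 1) (x - 1 - 2k) for x = 2i + 1.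
W : ℕ → ℕ → Series
W zero    m   = Z m
W (suc k) m n = α k m * W k (suc m) n + - β k m * W k m n

rise : ℚ → ℕ → ℚ
rise x zero    = 1ℚ
rise x (suc n) = x * rise (x + 1ℚ) n

rise-suc : ∀ x n → rise x (suc n) ≡ rise x n * (x + ι n)
rise-suc x zero    = solve 1 (λ x → x :* con 1ℚ := con 1ℚ :* (x :+ con 0ℚ)) refl x
rise-suc x (suc n) = begin
  x * rise (x + 1ℚ) (suc n)               ≡⟨ cong (x *_) (rise-suc (x + 1ℚ) n) ⟩
  x * (rise (x + 1ℚ) n * (x + 1ℚ + ι n))  ≡⟨ solve 3 (λ x r N → x :* (r :* (x :+ con 1ℚ :+ N)) := x :* r :* (x :+ (N :+ con 1ℚ))) refl x (rise (x + 1ℚ) n) (ι n) ⟩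
  x * rise (x + 1ℚ) n * (x + (ι n + 1ℚ))  ≡⟨ cong (λ y → x * rise (x + 1ℚ) n * (x + y)) (ι-suc n) ⟨
  rise x (suc n) * (x + ι (suc n))        ∎

-- The numerators of the moments after k elimination steps. The factors i - l with l < k produce the
-- zeros in the rows i < k.
residual : ℕ → ℕ → ℚ
residual zero    i = c i
residual (suc k) i = (ι k + 1ℚ) * (2ℚ * (ι i - ι k)) * residual k i

-- With x = 2i + m + 1, the moments of `W k m` and `W k (suc m)` have denominators x ⋯ (x + k) and
-- (x + 1) ⋯ (x + k + 1). Over the common denominator they acquire the factors x + k + 1 and x, and
-- the choice of `α` and `β` leaves the numerator factor (k + 1) · 2(i - k).
Φ-W : ∀ k m i → rise (pivot i m) (suc k) * Φ i (W k m) 0 ≡ residual k i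
Φ-W zero    m i = trans (cong (_* Φ i (Z m) 0) (*-identityʳ (pivot i m))) (Φ-Z m i)
Φ-W (suc k) m i = begin
  rise x (suc (suc k)) * Φ i (W (suc k) m) 0
    ≡⟨ cong (rise x (suc (suc k)) *_) (Φ-linear i (α k m) (- β k m) (W k (suc m)) (W k m) 0) ⟩
  x * rise (x + 1ℚ) (suc k) * (α k m * u + - β k m * w)
    ≡⟨ solve 6 (λ R α β u w S → R :* (α :* u :+ :- β :* w) := α :* (R :* u) :- β :* (R :* w)) refl
         (rise x (suc (suc k))) (α k m) (β k m) u w 0ℚ ⟩
  α k m * (x * rise (x + 1ℚ) (suc k) * u) - β k m * (rise x (suc (suc k)) * w)
    ≡⟨ cong₂ (λ p q → α k m * p - β k m * (q * w))
         (trans (*-assoc x (rise (x + 1ℚ) (suc k)) u)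
           (cong (x *_) (trans (cong (λ t → rise t (suc k) * u) next) (Φ-W k (suc m) i))))
         (rise-suc x (suc k)) ⟩
  α k m * (x * r) - β k m * (rise x (suc k) * (x + ι (suc k)) * w)
    ≡⟨ cong (λ t → α k m * (x * r) - β k m * t)
         (solve 3 (λ p q w → p :* q :* w := q :* (p :* w)) refl (rise x (suc k)) (x + ι (suc k)) w) ⟩
  α k m * (x * r) - β k m * ((x + ι (suc k)) * (rise x (suc k) * w))
    ≡⟨ cong₂ (λ p q → α k m * (x * r) - β k m * ((x + p) * q)) (ι-suc k) (Φ-W k m i) ⟩
  α k m * (x * r) - β k m * ((x + (ι k + 1ℚ)) * r)
    ≡⟨ solve 4 (λ K M I r →
         let x = con 2ℚ :* I :+ M :+ con 1ℚ in
         (con (2ℚ + 1ℚ) :* K :+ M :+ con 2ℚ) :* (x :* r) :- (con 2ℚ :* K :+ M :+ con 1ℚ) :* ((x :+ (K :+ con 1ℚ)) :* r)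
         := (K :+ con 1ℚ) :* (con 2ℚ :* (I :- K)) :* r) refl (ι k) (ι m) (ι i) r ⟩
  residual (suc k) i ∎
  where
  x = pivot i m
  r = residual k i
  u = Φ i (W k (suc m)) 0
  w = Φ i (W k m) 0
  next : x + 1ℚ ≡ pivot i (suc m)
  next = trans (cong (_+ 1ℚ) (+-assoc (2ℚ * ι i) (ι m) 1ℚ)) (cong (λ t → 2ℚ * ι i + t + 1ℚ) (sym (ι-suc m)))

residual-vanish : ∀ {i k} → i ℕ.< k → residual k i ≡ 0ℚ
residual-vanish {i} {suc k} i<sk with ℕ.m<1+n⇒m<n∨m≡n i<sk
... | inj₁ i<k  = trans (cong ((ι k + 1ℚ) * (2ℚ * (ι i - ι k)) *_) (residual-vanish i<k))
                        (*-zeroʳ ((ι k + 1ℚ) * (2ℚ * (ι i - ι k))))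
... | inj₂ refl = solve 2 (λ K r → (K :+ con 1ℚ) :* (con 2ℚ :* (K :- K)) :* r := con 0ℚ) refl (ι i) (residual i i)

-- Factorials and rising factorials

F : ℕ → ℚ
F n = ι (n !)

F≢0 : ∀ n → F n ≢ 0ℚ
F≢0 n = ι≢0 (n !) {{n ℕ.!≢0}}

F-suc : ∀ n → F (suc n) ≡ (ι n + 1ℚ) * F n
F-suc n = trans (ι-* (suc n) (n !)) (cong (_* F n) (ι-suc n))

rise-! : ∀ m k → rise (ι m + 1ℚ) k * F m ≡ F (m ℕ.+ k)
rise-! m zero    = trans (*-identityˡ (F m)) (cong F (sym (ℕ.+-identityʳ m)))
rise-! m (suc k) = begin
  (ι m + 1ℚ) * rise (ι m + 1ℚ + 1ℚ) k * F m
    ≡⟨ solve 3 (λ x y z → x :* y :* z := y :* (x :* z)) refl (ι m + 1ℚ) (rise (ι m + 1ℚ + 1ℚ) k) (F m) ⟩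
  rise (ι m + 1ℚ + 1ℚ) k * ((ι m + 1ℚ) * F m)
    ≡⟨ cong₂ (λ x y → rise (x + 1ℚ) k * y) (ι-suc m) (F-suc m) ⟨
  rise (ι (suc m) + 1ℚ) k * F (suc m)
    ≡⟨ rise-! (suc m) k ⟩
  F (suc m ℕ.+ k)
    ≡⟨ cong F (ℕ.+-suc m k) ⟨
  F (m ℕ.+ suc k) ∎

pivot-ι : ∀ i → pivot i 0 ≡ ι (2 ℕ.* i) + 1ℚ
pivot-ι i = cong (_+ 1ℚ) (trans (+-identityʳ (2ℚ * ι i)) (sym (ι-double i)))

-- The quotient (2i + k)!/(2i)!; `R i (suc k)` is the denominator of the i-th moment of `W k 0`.
R : ℕ → ℕ → ℚ
R i k = rise (pivot i 0) k

R-! : ∀ i k → R i k * F (2 ℕ.* i) ≡ F (2 ℕ.* i ℕ.+ k)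
R-! i k = trans (cong (λ x → rise x k * F (2 ℕ.* i)) (pivot-ι i)) (rise-! (2 ℕ.* i) k)

R≢0 : ∀ i k → R i k ≢ 0ℚ
R≢0 i k R≡0 = F≢0 (2 ℕ.* i ℕ.+ k) (begin
  F (2 ℕ.* i ℕ.+ k)      ≡⟨ R-! i k ⟨
  R i k * F (2 ℕ.* i)    ≡⟨ cong (_* F (2 ℕ.* i)) R≡0 ⟩
  0ℚ * F (2 ℕ.* i)       ≡⟨ *-zeroˡ (F (2 ℕ.* i)) ⟩
  0ℚ                     ∎)

Φ-W-vanish : ∀ {i n} → i ℕ.< n → Φ i (W n 0) 0 ≡ 0ℚ
Φ-W-vanish {i} {n} i<n = *-cancelˡ-≢0 (R≢0 i (suc n))
  (trans (Φ-W n 0 i) (trans (residual-vanish i<n) (sym (*-zeroʳ (R i (suc n))))))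

module _ (b : Series) (n : ℕ) (vanish : ∀ {i} → i ℕ.< n → Φ i b 0 ≡ 0ℚ) where

  private
    Φ-even : ∀ i k → Φ k b (2 ℕ.* suc i) ≡ Φ (suc k) b (2 ℕ.* i) + - (odd k * odd k) * Φ k b (2 ℕ.* i)
    Φ-even i k = trans (cong (Φ k b) (ℕ.*-suc 2 i))
      (solve 3 (λ x o y → x := x :+ o :* y :+ :- o :* y) refl
        (Φ k b (suc (suc (2 ℕ.* i)))) (odd k * odd k) (Φ k b (2 ℕ.* i)))

  -- D²φₖ is φ at k + 1 minus (2k + 1)²φₖ, so even derivatives reduce to the φ's; carrying k along
  -- makes this an induction on i. The case k = 0 concerns the even derivatives themselves.
  Φ-even-vanish : ∀ i k → i ℕ.+ k ℕ.< n → Φ k b (2 ℕ.* i) ≡ 0ℚ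
  Φ-even-vanish zero    k k<n   = vanish k<n
  Φ-even-vanish (suc i) k i+k<n = begin
    Φ k b (2 ℕ.* suc i)
      ≡⟨ Φ-even i k ⟩
    Φ (suc k) b (2 ℕ.* i) + - (odd k * odd k) * Φ k b (2 ℕ.* i)
      ≡⟨ cong₂ (λ x y → x + - (odd k * odd k) * y)
           (Φ-even-vanish i (suc k) (subst (ℕ._< n) (sym (ℕ.+-suc i k)) i+k<n))
           (Φ-even-vanish i k (ℕ.<-trans (ℕ.n<1+n (i ℕ.+ k)) i+k<n)) ⟩
    0ℚ + - (odd k * odd k) * 0ℚ
      ≡⟨ solve 1 (λ o → con 0ℚ :+ :- o :* con 0ℚ := con 0ℚ) refl (odd k * odd k) ⟩
    0ℚ ∎

  -- The same reduction on the diagonal i + k = n, where the correction term vanishes: the change of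
  -- basis is unitriangular.
  Φ-even-top : ∀ i k → i ℕ.+ k ≡ n → Φ k b (2 ℕ.* i) ≡ Φ n b 0
  Φ-even-top zero    k refl = refl
  Φ-even-top (suc i) k i+k≡n = begin
    Φ k b (2 ℕ.* suc i)
      ≡⟨ Φ-even i k ⟩
    Φ (suc k) b (2 ℕ.* i) + - (odd k * odd k) * Φ k b (2 ℕ.* i)
      ≡⟨ cong₂ (λ x y → x + - (odd k * odd k) * y)
           (Φ-even-top i (suc k) (trans (ℕ.+-suc i k) i+k≡n))
           (Φ-even-vanish i k (ℕ.≤-reflexive i+k≡n)) ⟩
    Φ n b 0 + - (odd k * odd k) * 0ℚ
      ≡⟨ solve 2 (λ x o → x :+ :- o :* con 0ℚ := x) refl (Φ n b 0) (odd k * odd k) ⟩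
    Φ n b 0 ∎

-- Leading coefficients and the one-step relation

E : ℕ → Series → Series
E zero    b = b
E (suc j) b = E j b ∘ suc

E-lookup : ∀ j b k → E j b k ≡ b (k ℕ.+ j)
E-lookup zero    b k = cong b (sym (ℕ.+-identityʳ k))
E-lookup (suc j) b k = trans (E-lookup j b (suc k)) (cong b (sym (ℕ.+-suc k j)))

-- Lead n l b: b is l times the n-th shift of a plus a combination of the earlier shifts.
data Lead : ℕ → ℚ → Series → Set where
  base  : Lead 0 1ℚ a
  shift : ∀ {n l b} → Lead n l b → Lead (suc n) l (b ∘ suc)
  lower : ∀ {n l b} → Lead n l b → Lead (suc n) 0ℚ b
  comb  : ∀ {n l l′ b b′} (p q : ℚ) → Lead n l b → Lead n l′ b′ →
          Lead n (p * l + q * l′) (λ k → p * b k + q * b′ k)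

-- A linear functional that kills the earlier shifts sees only the leading one. `T` varies in the
-- induction because the case `shift` passes to `T` precomposed with the shift.
evaluate-Lead : ∀ {n l b} → Lead n l b → (T : Series → ℚ) →
  (∀ p q b b′ → T (λ k → p * b k + q * b′ k) ≡ p * T b + q * T b′) →
  (∀ {j} → j ℕ.< n → T (E j a) ≡ 0ℚ) → T b ≡ l * T (E n a)
evaluate-Lead base T T-linear T≡0 = sym (*-identityˡ (T a))
evaluate-Lead (shift L) T T-linear T≡0 =
  evaluate-Lead L (λ b → T (b ∘ suc)) (λ p q b b′ → T-linear p q (b ∘ suc) (b′ ∘ suc)) (λ j<n → T≡0 (ℕ.s<s j<n))
evaluate-Lead {suc n} {b = b} (lower {l = l} L) T T-linear T≡0 = begin
  T b                ≡⟨ evaluate-Lead L T T-linear (λ j<n → T≡0 (ℕ.m<n⇒m<1+n j<n)) ⟩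
  l * T (E n a)      ≡⟨ cong (l *_) (T≡0 (ℕ.n<1+n n)) ⟩
  l * 0ℚ             ≡⟨ *-zeroʳ l ⟩
  0ℚ                 ≡⟨ *-zeroˡ (T (E (suc n) a)) ⟨
  0ℚ * T (E (suc n) a) ∎
evaluate-Lead {n} (comb {l = l} {l′} {b} {b′} p q L L′) T T-linear T≡0 = begin
  T (λ k → p * b k + q * b′ k)
    ≡⟨ T-linear p q b b′ ⟩
  p * T b + q * T b′
    ≡⟨ cong₂ (λ x y → p * x + q * y) (evaluate-Lead L T T-linear T≡0) (evaluate-Lead L′ T T-linear T≡0) ⟩
  p * (l * T (E n a)) + q * (l′ * T (E n a))
    ≡⟨ solve 5 (λ p q l l′ t → p :* (l :* t) :+ q :* (l′ :* t) := (p :* l :+ q :* l′) :* t) refl p q l l′ (T (E n a)) ⟩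
  (p * l + q * l′) * T (E n a) ∎

lam : ℕ → ℚ
lam zero          = 1ℚ
lam (suc zero)    = ½
lam (suc (suc m)) = 1/suc m * 1/suc m * lam m

Lead-Z : ∀ m → Lead m (lam m) (Z m)
Lead-Z zero          = base
-- The coefficient 0 mirrors the two-term shape of `Z 1`.
Lead-Z (suc zero)    = comb ½ 0ℚ (shift base) (shift base)
Lead-Z (suc (suc m)) = subst (λ l → Lead (suc (suc m)) l (Z (suc (suc m))))
  (solve 3 (λ s t l → s :* l :+ t :* con 0ℚ := s :* l) refl (s * s) (s * s * (ι m * ι m)) (lam m))
  (comb (s * s) (s * s * (ι m * ι m)) (shift (shift (Lead-Z m))) (lower (lower (Lead-Z m))))
  where s = 1/suc m

-- The product of the coefficients `α` that multiply the leading term on the way to `W k m`, where d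
-- = k + m: for l + m′ + 1 = d the factor `α l m′` equals d + 2l + 1.
ρ : ℕ → ℕ → ℚ
ρ zero    d = 1ℚ
ρ (suc k) d = (ι d + 2ℚ * ι k + 1ℚ) * ρ k d

-- Only the summand with `W k (suc m)` reaches order d; the one with `W k m` has order d - 1 and
-- enters through `lower`.
Lead-W : ∀ k m {d} → k ℕ.+ m ≡ d → Lead d (lam d * ρ k d) (W k m)
Lead-W zero    m refl = subst (λ l → Lead m l (Z m)) (sym (*-identityʳ (lam m))) (Lead-Z m)
Lead-W (suc k) m refl = subst (λ l → Lead d l (W (suc k) m)) (begin
  α k m * (lam d * ρ k d) + - β k m * 0ℚ
    ≡⟨ solve 4 (λ α β l r → α :* (l :* r) :+ :- β :* con 0ℚ := l :* (α :* r)) refl (α k m) (β k m) (lam d) (ρ k d) ⟩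
  lam d * (α k m * ρ k d)
    ≡⟨ cong (λ x → lam d * (x * ρ k d)) (begin
      α k m
        ≡⟨ solve 2 (λ K M → con (2ℚ + 1ℚ) :* K :+ M :+ con 2ℚ := K :+ M :+ con 1ℚ :+ con 2ℚ :* K :+ con 1ℚ) refl (ι k) (ι m) ⟩
      ι k + ι m + 1ℚ + 2ℚ * ι k + 1ℚ
        ≡⟨ cong (λ x → x + 2ℚ * ι k + 1ℚ) (trans (cong (_+ 1ℚ) (sym (ι-+ k m))) (sym (ι-suc (k ℕ.+ m)))) ⟩
      ι d + 2ℚ * ι k + 1ℚ ∎) ⟩
  lam d * ρ (suc k) d ∎)
  (comb (α k m) (- β k m) (Lead-W k (suc m) (ℕ.+-suc k m)) (lower (Lead-W k m refl)))
  where d = suc (k ℕ.+ m)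

ℓ : ℕ → ℚ
ℓ n = lam n * ρ n n

-- The determinant with last column taken from `W n 0` is computed twice. By linearity only the
-- leading shift counts, as the earlier ones repeat a column; on the other hand that column is zero
-- except at the bottom, where its entry is the n-th moment.
Ḧ-step : ∀ n → ℓ n * Ḧ (suc n) ≡ Φ n (W n 0) 0 * Ḧ n
Ḧ-step n = begin
  ℓ n * Ḧ (suc n)
    ≡⟨ cong (ℓ n *_) (det-cong λ i → lastColumn i) ⟨
  ℓ n * T (E n a)
    ≡⟨ evaluate-Lead (Lead-W n 0 (ℕ.+-identityʳ n)) T
         (λ p q b b′ → det-▹-linear A p q (λ i → b (2 ℕ.* toℕ i)) (λ i → b′ (2 ℕ.* toℕ i))) T≡0 ⟨
  T (W n 0)
    ≡⟨ det-▹-corner A (λ i → W n 0 (2 ℕ.* toℕ i)) (λ i → Φ-even-vanish (W n 0) n Φ-W-vanish (toℕ (inject₁ i)) 0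
         (subst (ℕ._< n) (trans (sym (toℕ-inject₁ i)) (sym (ℕ.+-identityʳ (toℕ (inject₁ i))))) (toℕ<n i))) ⟩
  W n 0 (2 ℕ.* toℕ (fromℕ n)) * det (A ∘ inject₁)
    ≡⟨ cong₂ _*_
         (Φ-even-top (W n 0) n Φ-W-vanish (toℕ (fromℕ n)) 0 (trans (ℕ.+-identityʳ (toℕ (fromℕ n))) (toℕ-fromℕ n)))
         (det-cong {n} λ i j → cong (λ m → a (2 ℕ.* m ℕ.+ toℕ j)) (toℕ-inject₁ i)) ⟩
  Φ n (W n 0) 0 * Ḧ n ∎
  where
  A : Matrix (suc n) n
  A i j = a (2 ℕ.* toℕ i ℕ.+ toℕ j)
  T : Series → ℚ
  T b = det (A ▹ λ i → b (2 ℕ.* toℕ i))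
  row : Fin (suc n) → Fin (suc n) → ℚ
  row i j = a (2 ℕ.* toℕ i ℕ.+ toℕ j)
  ∷ʳ-cong : ∀ {m} {v v′ : Fin m → ℚ} {x x′} → v ≗ v′ → x ≡ x′ → v ∷ʳ x ≗ v′ ∷ʳ x′
  ∷ʳ-cong {zero}  v≗ x≡ zero    = x≡
  ∷ʳ-cong {suc m} v≗ x≡ zero    = v≗ zero
  ∷ʳ-cong {suc m} v≗ x≡ (suc j) = ∷ʳ-cong (v≗ ∘ suc) x≡ j
  lastColumn : ∀ i j → (A ▹ λ i → E n a (2 ℕ.* toℕ i)) i j ≡ row i j
  lastColumn i j = trans
    (∷ʳ-cong (λ j → cong (λ m → a (2 ℕ.* toℕ i ℕ.+ m)) (sym (toℕ-inject₁ j)))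
      (trans (E-lookup n a (2 ℕ.* toℕ i)) (cong (λ m → a (2 ℕ.* toℕ i ℕ.+ m)) (sym (toℕ-fromℕ n)))) j)
    (∷ʳ-eta (row i) j)
  T≡0 : ∀ {j} → j ℕ.< n → T (E j a) ≡ 0ℚ
  T≡0 {j} j<n = trans
    (det-cong λ i → ∷ʳ-cong {v = A i} (λ _ → refl)
      (trans (E-lookup j a (2 ℕ.* toℕ i)) (cong (λ m → a (2 ℕ.* toℕ i ℕ.+ m)) (sym (toℕ-fromℕ< j<n)))))
    (det-▹-repeated A (fromℕ< j<n))

-- The recurrence

-- The product of i - l over l < k is i!/d! with d = i - k; multiplying by `F d` avoids the
-- division.
residual-! : ∀ k d {i} → k ℕ.+ d ≡ i → residual k i * F d ≡ c i * (F k * 2ℚ ^ k * F i)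
residual-! zero    d refl = solve 2 (λ c f → c :* f := c :* (con 1ℚ :* con 1ℚ :* f)) refl (c d) (F d)
residual-! (suc k) d refl = begin
  (ι k + 1ℚ) * (2ℚ * (ι i - ι k)) * residual k i * F d
    ≡⟨ cong (λ x → (ι k + 1ℚ) * (2ℚ * (x - ι k)) * residual k i * F d)
         (trans (ι-suc (k ℕ.+ d)) (cong (_+ 1ℚ) (ι-+ k d))) ⟩
  (ι k + 1ℚ) * (2ℚ * (ι k + ι d + 1ℚ - ι k)) * residual k i * F d
    ≡⟨ solve 4 (λ K D r f → (K :+ con 1ℚ) :* (con 2ℚ :* (K :+ D :+ con 1ℚ :- K)) :* r :* f
         := (K :+ con 1ℚ) :* con 2ℚ :* (r :* ((D :+ con 1ℚ) :* f))) refl (ι k) (ι d) (residual k i) (F d) ⟩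
  (ι k + 1ℚ) * 2ℚ * (residual k i * ((ι d + 1ℚ) * F d))
    ≡⟨ cong (λ x → (ι k + 1ℚ) * 2ℚ * (residual k i * x)) (F-suc d) ⟨
  (ι k + 1ℚ) * 2ℚ * (residual k i * F (suc d))
    ≡⟨ cong ((ι k + 1ℚ) * 2ℚ *_) (residual-! k (suc d) (ℕ.+-suc k d)) ⟩
  (ι k + 1ℚ) * 2ℚ * (c i * (F k * 2ℚ ^ k * F i))
    ≡⟨ solve 5 (λ K c f t g → (K :+ con 1ℚ) :* con 2ℚ :* (c :* (f :* t :* g))
         := c :* ((K :+ con 1ℚ) :* f :* (con 2ℚ :* t) :* g)) refl (ι k) (c i) (F k) (2ℚ ^ k) (F i) ⟩
  c i * ((ι k + 1ℚ) * F k * 2ℚ ^ suc k * F i)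
    ≡⟨ cong (λ x → c i * (x * 2ℚ ^ suc k * F i)) (F-suc k) ⟨
  c i * (F (suc k) * 2ℚ ^ suc k * F i) ∎
  where i = suc (k ℕ.+ d)

κ : ℕ → ℚ
κ n = residual n n

κ-closed : ∀ n → κ n ≡ c n * (F n * 2ℚ ^ n * F n)
κ-closed n = trans (sym (*-identityʳ (κ n))) (residual-! n 0 (ℕ.+-identityʳ n))

κ-suc : ∀ n → κ (suc n) ≡ ι 8 * ((ι n + 1ℚ) ^ 4 * κ n)
κ-suc n = begin
  κ (suc n)
    ≡⟨ κ-closed (suc n) ⟩
  even n * even n * c n * (F (suc n) * 2ℚ ^ suc n * F (suc n))
    ≡⟨ cong (λ x → even n * even n * c n * (x * 2ℚ ^ suc n * x)) (F-suc n) ⟩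
  even n * even n * c n * ((ι n + 1ℚ) * F n * (2ℚ * 2ℚ ^ n) * ((ι n + 1ℚ) * F n))
    ≡⟨ solve 4 (λ N c f t → let e = con 2ℚ :* N :+ con 2ℚ ; s = N :+ con 1ℚ in
         e :* e :* c :* (s :* f :* (con 2ℚ :* t) :* (s :* f))
         := con (ι 8) :* (s :* (s :* (s :* (s :* con 1ℚ))) :* (c :* (f :* t :* f)))) refl
         (ι n) (c n) (F n) (2ℚ ^ n) ⟩
  ι 8 * ((ι n + 1ℚ) ^ 4 * (c n * (F n * 2ℚ ^ n * F n)))
    ≡⟨ cong (λ x → ι 8 * ((ι n + 1ℚ) ^ 4 * x)) (κ-closed n) ⟨
  ι 8 * ((ι n + 1ℚ) ^ 4 * κ n) ∎

-- In fact κ n = 8^n (n!)^4. The two-step recurrence contains κ (n + 1) κ n, which `κ-suc` turns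
-- into this square; hence the power of 64 in `Q`.
κ² : ∀ n → κ n * κ n ≡ ι (64 ℕ.^ n) * F n ^ 8
κ² zero    = refl
κ² (suc n) = begin
  κ (suc n) * κ (suc n)
    ≡⟨ cong (λ x → x * x) (κ-suc n) ⟩
  ι 8 * ((ι n + 1ℚ) ^ 4 * κ n) * (ι 8 * ((ι n + 1ℚ) ^ 4 * κ n))
    ≡⟨ solve 2 (λ s k → con (ι 8) :* (s :* k) :* (con (ι 8) :* (s :* k)) := con (ι 64) :* (s :* s) :* (k :* k)) refl
         ((ι n + 1ℚ) ^ 4) (κ n) ⟩
  ι 64 * ((ι n + 1ℚ) ^ 4 * (ι n + 1ℚ) ^ 4) * (κ n * κ n)
    ≡⟨ cong (ι 64 * ((ι n + 1ℚ) ^ 4 * (ι n + 1ℚ) ^ 4) *_) (κ² n) ⟩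
  ι 64 * ((ι n + 1ℚ) ^ 4 * (ι n + 1ℚ) ^ 4) * (ι (64 ℕ.^ n) * F n ^ 8)
    ≡⟨ solve 3 (λ s g f →
         let p4 = λ x → x :* (x :* (x :* (x :* con 1ℚ)))
             p8 = λ x → x :* (x :* (x :* (x :* (x :* (x :* (x :* (x :* con 1ℚ)))))))  in
         con (ι 64) :* (p4 s :* p4 s) :* (g :* p8 f) := con (ι 64) :* g :* p8 (s :* f)) refl
         (ι n + 1ℚ) (ι (64 ℕ.^ n)) (F n) ⟩
  ι 64 * ι (64 ℕ.^ n) * ((ι n + 1ℚ) * F n) ^ 8
    ≡⟨ cong₂ (λ x y → x * y ^ 8) (ι-* 64 (64 ℕ.^ n)) (F-suc n) ⟨
  ι (64 ℕ.^ suc n) * F (suc n) ^ 8 ∎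

-- `lam` advances by two, so its closed form depends on the parity of m, but the product of two
-- neighbours is 1/(2 (m!)²). This is what makes two steps at once simple.
lam-product : ∀ m → 2ℚ * (F m * F m) * (lam m * lam (suc m)) ≡ 1ℚ
lam-product zero    = refl
lam-product (suc m) = begin
  2ℚ * (F (suc m) * F (suc m)) * (lam (suc m) * (s * s * lam m))
    ≡⟨ cong (λ x → 2ℚ * (x * x) * (lam (suc m) * (s * s * lam m))) (F-suc m) ⟩
  2ℚ * ((ι m + 1ℚ) * F m * ((ι m + 1ℚ) * F m)) * (lam (suc m) * (s * s * lam m))
    ≡⟨ solve 5 (λ N f s l l′ → con 2ℚ :* (N :* f :* (N :* f)) :* (l′ :* (s :* s :* l))
         := N :* s :* (N :* s) :* (con 2ℚ :* (f :* f) :* (l :* l′))) refl (ι m + 1ℚ) (F m) s (lam m) (lam (suc m)) ⟩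
  (ι m + 1ℚ) * s * ((ι m + 1ℚ) * s) * (2ℚ * (F m * F m) * (lam m * lam (suc m)))
    ≡⟨ cong₂ (λ x y → x * x * y) (1/suc-inverse m) (lam-product m) ⟩
  1ℚ * 1ℚ * 1ℚ
    ≡⟨⟩
  1ℚ ∎
  where s = 1/suc m

-- The factors n + 1, n + 3, ... of `ρ k n` interleave with the factors n + 2, n + 4, ... of
-- `ρ k (suc n)`.
ρ-! : ∀ k n → ρ k n * ρ k (suc n) * F n ≡ F (2 ℕ.* k ℕ.+ n)
ρ-! zero    n = trans (cong (_* F n) (*-identityˡ 1ℚ)) (*-identityˡ (F n))
ρ-! (suc k) n = begin
  (ι n + 2ℚ * ι k + 1ℚ) * ρ k n * ((ι (suc n) + 2ℚ * ι k + 1ℚ) * ρ k (suc n)) * F n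
    ≡⟨ cong (λ x → (ι n + 2ℚ * ι k + 1ℚ) * ρ k n * ((x + 2ℚ * ι k + 1ℚ) * ρ k (suc n)) * F n) (ι-suc n) ⟩
  (ι n + 2ℚ * ι k + 1ℚ) * ρ k n * ((ι n + 1ℚ + 2ℚ * ι k + 1ℚ) * ρ k (suc n)) * F n
    ≡⟨ solve 5 (λ N K r r′ f → (N :+ con 2ℚ :* K :+ con 1ℚ) :* r :* ((N :+ con 1ℚ :+ con 2ℚ :* K :+ con 1ℚ) :* r′) :* f
         := (con 2ℚ :* K :+ N :+ con 1ℚ :+ con 1ℚ) :* ((con 2ℚ :* K :+ N :+ con 1ℚ) :* (r :* r′ :* f))) refl
         (ι n) (ι k) (ρ k n) (ρ k (suc n)) (F n) ⟩
  (2ℚ * ι k + ι n + 1ℚ + 1ℚ) * ((2ℚ * ι k + ι n + 1ℚ) * (ρ k n * ρ k (suc n) * F n))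
    ≡⟨ cong₂ (λ x y → (x + 1ℚ + 1ℚ) * ((x + 1ℚ) * y))
         (trans (cong (_+ ι n) (sym (ι-double k))) (sym (ι-+ (2 ℕ.* k) n))) (ρ-! k n) ⟩
  (ι t + 1ℚ + 1ℚ) * ((ι t + 1ℚ) * F t)
    ≡⟨ cong₂ (λ x y → (x + 1ℚ) * y) (ι-suc t) (F-suc t) ⟨
  (ι (suc t) + 1ℚ) * F (suc t)
    ≡⟨ F-suc (suc t) ⟨
  F (suc (suc t))
    ≡⟨ cong F (cong (ℕ._+ n) (sym (ℕ.*-suc 2 k))) ⟩
  F (2 ℕ.* suc k ℕ.+ n) ∎
  where t = 2 ℕ.* k ℕ.+ n

Ḧ-step′ : ∀ n → R n (suc n) * ℓ n * Ḧ (suc n) ≡ κ n * Ḧ n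
Ḧ-step′ n = begin
  R n (suc n) * ℓ n * Ḧ (suc n)
    ≡⟨ *-assoc (R n (suc n)) (ℓ n) (Ḧ (suc n)) ⟩
  R n (suc n) * (ℓ n * Ḧ (suc n))
    ≡⟨ cong (R n (suc n) *_) (Ḧ-step n) ⟩
  R n (suc n) * (Φ n (W n 0) 0 * Ḧ n)
    ≡⟨ *-assoc (R n (suc n)) (Φ n (W n 0) 0) (Ḧ n) ⟨
  R n (suc n) * Φ n (W n 0) 0 * Ḧ n
    ≡⟨ cong (_* Ḧ n) (Φ-W n 0 n) ⟩
  κ n * Ḧ n ∎

3ℚ : ℚ
3ℚ = 2ℚ + 1ℚ

ι-Q-num : ∀ n → ι (Q-num n) ≡
  ι 144 * ι (64 ℕ.^ n) * F n ^ 5 * ((ι n + 1ℚ) * F n) ^ 6 * F (2 ℕ.* n) * F (suc (2 ℕ.* n))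
ι-Q-num n = begin
  ι (144 ℕ.* 64 ℕ.^ n ℕ.* (n !) ℕ.^ 5 ℕ.* ((n ℕ.+ 1) !) ℕ.^ 6 ℕ.* (2 ℕ.* n) ! ℕ.* (2 ℕ.* n ℕ.+ 1) !)
    ≡⟨ ι-* (144 ℕ.* 64 ℕ.^ n ℕ.* (n !) ℕ.^ 5 ℕ.* ((n ℕ.+ 1) !) ℕ.^ 6 ℕ.* (2 ℕ.* n) !) _ ⟩
  ι (144 ℕ.* 64 ℕ.^ n ℕ.* (n !) ℕ.^ 5 ℕ.* ((n ℕ.+ 1) !) ℕ.^ 6 ℕ.* (2 ℕ.* n) !) * F (2 ℕ.* n ℕ.+ 1)
    ≡⟨ cong₂ _*_ (ι-* (144 ℕ.* 64 ℕ.^ n ℕ.* (n !) ℕ.^ 5 ℕ.* ((n ℕ.+ 1) !) ℕ.^ 6) _) (cong F (ℕ.+-comm (2 ℕ.* n) 1)) ⟩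
  ι (144 ℕ.* 64 ℕ.^ n ℕ.* (n !) ℕ.^ 5 ℕ.* ((n ℕ.+ 1) !) ℕ.^ 6) * F (2 ℕ.* n) * F (suc (2 ℕ.* n))
    ≡⟨ cong (λ x → x * F (2 ℕ.* n) * F (suc (2 ℕ.* n))) (trans
         (ι-* (144 ℕ.* 64 ℕ.^ n ℕ.* (n !) ℕ.^ 5) _)
         (cong₂ _*_
           (trans (ι-* (144 ℕ.* 64 ℕ.^ n) _) (cong₂ _*_ (ι-* 144 (64 ℕ.^ n)) (ι-^ (n !) 5)))
           (trans (ι-^ ((n ℕ.+ 1) !) 6) (cong (_^ 6) (trans (cong F (ℕ.+-comm n 1)) (F-suc n)))))) ⟩
  ι 144 * ι (64 ℕ.^ n) * F n ^ 5 * ((ι n + 1ℚ) * F n) ^ 6 * F (2 ℕ.* n) * F (suc (2 ℕ.* n)) ∎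

ι-Q-den : ∀ n → ι (Q-den n) ≡ F (3 ℕ.* n) * F (3 ℕ.* n ℕ.+ 3) * F (3 ℕ.* n ℕ.+ 4)
ι-Q-den n = trans (ι-* ((3 ℕ.* n) ! ℕ.* (3 ℕ.* n ℕ.+ 3) !) _)
  (cong (_* F (3 ℕ.* n ℕ.+ 4)) (ι-* ((3 ℕ.* n) !) _))

-- The factorials of `Q-den` supply the coefficients of two consecutive steps: (3n)! the products
-- `ρ`, (3n + 3)! the factor `R n (suc n)`, and (3n + 4)! the factor `R (suc n) (suc (suc n))`.
F-3n : ∀ n → F (3 ℕ.* n) ≡ ρ n n * ρ n (suc n) * F n
F-3n n = trans (cong F (lemma n)) (sym (ρ-! n n))
  where
  lemma : ∀ n → 3 ℕ.* n ≡ 2 ℕ.* n ℕ.+ n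
  lemma = solve-∀

F-3n+3 : ∀ n → F (3 ℕ.* n ℕ.+ 3) ≡ (3ℚ * ι n + 3ℚ) * ((3ℚ * ι n + 2ℚ) * (R n (suc n) * F (2 ℕ.* n)))
F-3n+3 n = begin
  F (3 ℕ.* n ℕ.+ 3)
    ≡⟨ cong F (lemma n) ⟩
  F (suc (suc t))
    ≡⟨ F-suc (suc t) ⟩
  (ι (suc t) + 1ℚ) * F (suc t)
    ≡⟨ cong₂ (λ x y → (x + 1ℚ) * y) (ι-suc t) (F-suc t) ⟩
  (ι t + 1ℚ + 1ℚ) * ((ι t + 1ℚ) * F t)
    ≡⟨ cong₂ (λ x y → (x + 1ℚ + 1ℚ) * ((x + 1ℚ) * y)) (begin
         ι (2 ℕ.* n ℕ.+ suc n)    ≡⟨ ι-+ (2 ℕ.* n) (suc n) ⟩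
         ι (2 ℕ.* n) + ι (suc n)  ≡⟨ cong₂ _+_ (ι-double n) (ι-suc n) ⟩
         2ℚ * ι n + (ι n + 1ℚ)    ∎) (sym (R-! n (suc n))) ⟩
  (2ℚ * ι n + (ι n + 1ℚ) + 1ℚ + 1ℚ) * ((2ℚ * ι n + (ι n + 1ℚ) + 1ℚ) * (R n (suc n) * F (2 ℕ.* n)))
    ≡⟨ solve 2 (λ N z → (con 2ℚ :* N :+ (N :+ con 1ℚ) :+ con 1ℚ :+ con 1ℚ) :* ((con 2ℚ :* N :+ (N :+ con 1ℚ) :+ con 1ℚ) :* z)
         := (con 3ℚ :* N :+ con 3ℚ) :* ((con 3ℚ :* N :+ con 2ℚ) :* z)) refl (ι n) (R n (suc n) * F (2 ℕ.* n)) ⟩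
  (3ℚ * ι n + 3ℚ) * ((3ℚ * ι n + 2ℚ) * (R n (suc n) * F (2 ℕ.* n))) ∎
  where
  t = 2 ℕ.* n ℕ.+ suc n
  lemma : ∀ n → 3 ℕ.* n ℕ.+ 3 ≡ suc (suc (2 ℕ.* n ℕ.+ suc n))
  lemma = solve-∀

F-3n+4 : ∀ n → F (3 ℕ.* n ℕ.+ 4) ≡ R (suc n) (suc (suc n)) * (even n * F (suc (2 ℕ.* n)))
F-3n+4 n = begin
  F (3 ℕ.* n ℕ.+ 4)
    ≡⟨ cong F (lemma n) ⟩
  F (2 ℕ.* suc n ℕ.+ suc (suc n))
    ≡⟨ R-! (suc n) (suc (suc n)) ⟨
  R (suc n) (suc (suc n)) * F (2 ℕ.* suc n)
    ≡⟨ cong (R (suc n) (suc (suc n)) *_) (begin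
         F (2 ℕ.* suc n)                                ≡⟨ cong F (ℕ.*-suc 2 n) ⟩
         F (suc (suc (2 ℕ.* n)))                        ≡⟨ F-suc (suc (2 ℕ.* n)) ⟩
         (ι (suc (2 ℕ.* n)) + 1ℚ) * F (suc (2 ℕ.* n))   ≡⟨ cong (λ x → (x + 1ℚ) * F (suc (2 ℕ.* n))) (trans (ι-suc (2 ℕ.* n)) (cong (_+ 1ℚ) (ι-double n))) ⟩
         (2ℚ * ι n + 1ℚ + 1ℚ) * F (suc (2 ℕ.* n))       ≡⟨ cong (_* F (suc (2 ℕ.* n))) (+-assoc (2ℚ * ι n) 1ℚ 1ℚ) ⟩
         even n * F (suc (2 ℕ.* n))                     ∎) ⟩
  R (suc n) (suc (suc n)) * (even n * F (suc (2 ℕ.* n))) ∎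
  where
  lemma : ∀ n → 3 ℕ.* n ℕ.+ 4 ≡ 2 ℕ.* suc n ℕ.+ suc (suc n)
  lemma = solve-∀

⅔ : ℚ
⅔ = ℤ.+ 2 / 3

-- After multiplication by `Q-den n`, the left side contains the coefficients of `Ḧ-step′` at n and
-- n + 1; the cofactor `z` and the two values of `κ` make up `Q-num n`.
Ḧ-recurrence : ∀ n → Ḧ (suc (suc n)) ≡ ⅔ * Q n * Ḧ n
Ḧ-recurrence n = *-cancelˡ-≢0 (ι≢0 (Q-den n) {{Q-den≢0 n}}) (begin
  ι (Q-den n) * h₂
    ≡⟨ cong (_* h₂) (ι-Q-den n) ⟩
  F (3 ℕ.* n) * F (3 ℕ.* n ℕ.+ 3) * F (3 ℕ.* n ℕ.+ 4) * h₂
    ≡⟨ cong₂ (λ x y → x * F (3 ℕ.* n ℕ.+ 3) * y * h₂) (F-3n n) (F-3n+4 n) ⟩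
  r * r′ * φ * F (3 ℕ.* n ℕ.+ 3) * (R₁ * (even n * d′)) * h₂
    ≡⟨ cong (λ x → r * r′ * φ * x * (R₁ * (even n * d′)) * h₂) (F-3n+3 n) ⟩
  r * r′ * φ * ((3ℚ * ι n + 3ℚ) * ((3ℚ * ι n + 2ℚ) * (R₀ * d))) * (R₁ * (even n * d′)) * h₂
    -- This 1 is then replaced by means of `lam-product`, to bring in the factors `lam` of `ℓ n` and
    -- `ℓ (suc n)`.
    ≡⟨ *-identityˡ y ⟨
  1ℚ * y
    ≡⟨ cong (_* y) (lam-product n) ⟨
  2ℚ * (φ * φ) * (l * l′) * y
    ≡⟨ reorder φ l l′ r r′ (3ℚ * ι n + 3ℚ) (3ℚ * ι n + 2ℚ) R₀ d R₁ (even n) d′ h₂ ⟩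
  z * (R₀ * (l * r) * (R₁ * (l′ * ((3ℚ * ι n + 2ℚ) * r′)) * h₂))
    -- The factor 3n + 2 from (3n + 3)! turns `ρ n (suc n)` into `ρ (suc n) (suc n)` and so
    -- completes `ℓ (suc n)`.
    ≡⟨ cong (λ x → z * (R₀ * (l * r) * (R₁ * (l′ * (x * r′)) * h₂))) (begin
         3ℚ * ι n + 2ℚ                  ≡⟨ solve 1 (λ N → con 3ℚ :* N :+ con 2ℚ := N :+ con 1ℚ :+ con 2ℚ :* N :+ con 1ℚ) refl (ι n) ⟩
         ι n + 1ℚ + 2ℚ * ι n + 1ℚ       ≡⟨ cong (λ x → x + 2ℚ * ι n + 1ℚ) (ι-suc n) ⟨
         ι (suc n) + 2ℚ * ι n + 1ℚ      ∎) ⟩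
  z * (R₀ * ℓ n * (R₁ * ℓ (suc n) * h₂))
    ≡⟨ cong (λ x → z * (R₀ * ℓ n * x)) (Ḧ-step′ (suc n)) ⟩
  z * (R₀ * ℓ n * (κ (suc n) * Ḧ (suc n)))
    ≡⟨ solve 4 (λ z p k h → z :* (p :* (k :* h)) := z :* k :* (p :* h)) refl z (R₀ * ℓ n) (κ (suc n)) (Ḧ (suc n)) ⟩
  z * κ (suc n) * (R₀ * ℓ n * Ḧ (suc n))
    ≡⟨ cong₂ (λ x y → z * x * y) (κ-suc n) (Ḧ-step′ n) ⟩
  z * (ι 8 * ((ι n + 1ℚ) ^ 4 * κ n)) * (κ n * h₀)
    ≡⟨ solve 5 (λ z e s k h → z :* (e :* (s :* k)) :* (k :* h) := z :* e :* s :* (k :* k) :* h) refl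
         z (ι 8) ((ι n + 1ℚ) ^ 4) (κ n) h₀ ⟩
  z * ι 8 * (ι n + 1ℚ) ^ 4 * (κ n * κ n) * h₀
    ≡⟨ cong (λ x → z * ι 8 * (ι n + 1ℚ) ^ 4 * x * h₀) (κ² n) ⟩
  z * ι 8 * (ι n + 1ℚ) ^ 4 * (ι (64 ℕ.^ n) * φ ^ 8) * h₀
    -- The constants match as 2 · 3 · 2 · 8 = 96 = ⅔ · 144, where 3 and 2 come from 3n + 3 and 2n +
    -- 2.
    ≡⟨ solve 6 (λ N φ d d′ g h →
         let p4 = λ x → x :* (x :* (x :* (x :* con 1ℚ)))
             p5 = λ x → x :* p4 x
             p6 = λ x → x :* p5 x
             p8 = λ x → x :* (x :* p6 x)
             s = N :+ con 1ℚ in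
         con 2ℚ :* (φ :* φ) :* (φ :* ((con 3ℚ :* N :+ con 3ℚ) :* (d :* ((con 2ℚ :* N :+ con 2ℚ) :* d′))))
           :* con (ι 8) :* p4 s :* (g :* p8 φ) :* h
         := con ⅔ :* (con (ι 144) :* g :* p5 φ :* p6 (s :* φ) :* d :* d′) :* h) refl
         (ι n) φ d d′ (ι (64 ℕ.^ n)) h₀ ⟩
  ⅔ * (ι 144 * ι (64 ℕ.^ n) * φ ^ 5 * ((ι n + 1ℚ) * φ) ^ 6 * d * d′) * h₀
    ≡⟨ cong (λ x → ⅔ * x * h₀) (ι-Q-num n) ⟨
  ⅔ * ι (Q-num n) * h₀
    ≡⟨ cong (λ x → ⅔ * x * h₀) (ι-cancel (ℤ.+ Q-num n) (Q-den n) {{Q-den≢0 n}}) ⟨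
  ⅔ * (ι (Q-den n) * Q n) * h₀
    ≡⟨ solve 4 (λ t q x h → t :* (q :* x) :* h := q :* (t :* x :* h)) refl ⅔ (ι (Q-den n)) (Q n) h₀ ⟩
  ι (Q-den n) * (⅔ * Q n * h₀) ∎)
  where
  h₀ = Ḧ n
  h₂ = Ḧ (suc (suc n))
  φ = F n
  d = F (2 ℕ.* n)
  d′ = F (suc (2 ℕ.* n))
  l = lam n
  l′ = lam (suc n)
  r = ρ n n
  r′ = ρ n (suc n)
  R₀ = R n (suc n)
  R₁ = R (suc n) (suc (suc n))
  y = r * r′ * φ * ((3ℚ * ι n + 3ℚ) * ((3ℚ * ι n + 2ℚ) * (R₀ * d))) * (R₁ * (even n * d′)) * h₂
  z = 2ℚ * (φ * φ) * (φ * ((3ℚ * ι n + 3ℚ) * (d * (even n * d′))))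
  reorder : ∀ φ l l′ r r′ t u R₀ d R₁ e d′ h →
    2ℚ * (φ * φ) * (l * l′) * (r * r′ * φ * (t * (u * (R₀ * d))) * (R₁ * (e * d′)) * h)
    ≡ 2ℚ * (φ * φ) * (φ * (t * (d * (e * d′)))) * (R₀ * (l * r) * (R₁ * (l′ * (u * r′)) * h))
  reorder = solve 13 (λ φ l l′ r r′ t u R₀ d R₁ e d′ h →
    con 2ℚ :* (φ :* φ) :* (l :* l′) :* (r :* r′ :* φ :* (t :* (u :* (R₀ :* d))) :* (R₁ :* (e :* d′)) :* h)
    := con 2ℚ :* (φ :* φ) :* (φ :* (t :* (d :* (e :* d′)))) :* (R₀ :* (l :* r) :* (R₁ :* (l′ :* (u :* r′)) :* h))) refl

-- The index map `g` covers both parities, `g N` being 2N or 2N + 1.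
Ḧ-product : ∀ (g : ℕ → ℕ) → (∀ N → g (suc N) ≡ suc (suc (g N))) → Ḧ (g 0) ≡ 1ℚ →
  ∀ N → Ḧ (g N) ≡ ⅔ ^ N * product {N} (λ k → Q (g (toℕ k)))
Ḧ-product g g-suc Ḧg₀ zero    = Ḧg₀
Ḧ-product g g-suc Ḧg₀ (suc N) = begin
  Ḧ (g (suc N))
    ≡⟨ cong Ḧ (g-suc N) ⟩
  Ḧ (suc (suc (g N)))
    ≡⟨ Ḧ-recurrence (g N) ⟩
  ⅔ * Q (g N) * Ḧ (g N)
    ≡⟨ cong₂ (λ x y → ⅔ * Q (g x) * y) (sym (toℕ-fromℕ N)) (Ḧ-product g g-suc Ḧg₀ N) ⟩
  ⅔ * Q (g (toℕ (fromℕ N))) * (⅔ ^ N * product {N} (λ k → Q (g (toℕ k))))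
    ≡⟨ solve 4 (λ t q s p → t :* q :* (s :* p) := t :* s :* (p :* q)) refl ⅔ (Q (g (toℕ (fromℕ N)))) (⅔ ^ N) (product {N} (λ k → Q (g (toℕ k)))) ⟩
  ⅔ ^ suc N * (product {N} (λ k → Q (g (toℕ k))) * Q (g (toℕ (fromℕ N))))
    ≡⟨ cong (λ x → ⅔ ^ suc N * (x * Q (g (toℕ (fromℕ N))))) (product-cong-≗ {N} λ k → cong (Q ∘ g) (toℕ-inject₁ k)) ⟨
  ⅔ ^ suc N * (product {N} (λ k → Q (g (toℕ (inject₁ k)))) * Q (g (toℕ (fromℕ N))))
    ≡⟨ cong (⅔ ^ suc N *_) (product-init-last {N} λ k → Q (g (toℕ k))) ⟨
  ⅔ ^ suc N * product {suc N} (λ k → Q (g (toℕ k))) ∎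

open import Data.Integer.Base using (+_)

theorem18p1 : ((n : ℕ) → Ḧ (n ℕ.+ 2) ≡ + 2 / 3 * Q n * Ḧ n)
    × ((N : ℕ) →
    Ḧ (2 ℕ.* N) ≡ (+ 2 / 3) ^ N * product {N} (λ k → Q (2 ℕ.* toℕ k))
    × Ḧ (2 ℕ.* N ℕ.+ 1) ≡ (+ 2 / 3) ^ N * product {N} (λ k → Q (2 ℕ.* toℕ k ℕ.+ 1)))
theorem18p1 =
  (λ n → trans (cong Ḧ (ℕ.+-comm n 2)) (Ḧ-recurrence n)) ,
  -- The initial values `Ḧ 0` and `Ḧ 1` both compute to 1.
  λ N → Ḧ-product (2 ℕ.*_) (ℕ.*-suc 2) refl N ,
        Ḧ-product (λ M → 2 ℕ.* M ℕ.+ 1) (λ M → cong (ℕ._+ 1) (ℕ.*-suc 2 M)) refl N
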